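{- Let $n\ge1$. There exists a bijection between the set of complete non-ambiguous forests with $n$ leaves and the set of pairs $(\alpha,\beta)$ of permutations of $\{1,\dots,n\}$ with no common rise. In particular these two sets have the same cardinality.
   Context: A non-ambiguous forest is a finite set $A\subseteq\mathbb N^+\times\mathbb N^+$ of points $p=(x(p),y(p))$ such that: (i) if some point of $A$ has first coordinate $x$ then for every $1\le x'<x$ some point of $A$ has first coordinate $x'$, and likewise for second coordinates; (ii) there is no $p\in A$ for which there exist both $q\in A$ with $x(q)=x(p)$, $y(q)<y(p)$ and $s\in A$ with $y(s)=y(p)$, $x(s)<x(p)$. It carries a rooted forest structure on vertex set $A$: the parent of $p$ is the point $q\in A$ with $x(q)=x(p)$ and $y(q)<y(p)$ maximal if such $q$ exists; otherwise the point $s\in A$ with $y(s)=y(p)$ and $x(s)<x(p)$ maximal if such $s$ exists; otherwise $p$ is a root. A leaf is a point with no children. The forest is complete if every point has either $0$ or $2$ children. For permutations $\alpha=(a_1,\dots,a_n)$, $\beta=(b_1,\dots,b_n)$ of $\{1,\dots,n\}$, the pair $(\alpha,\beta)$ has a common rise at position $i$ ($1\le i\le n-1$) if $a_i<a_{i+1}$ and $b_i<b_{i+1}$. -}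

module Defs where

open import Data.Nat using (ℕ; suc; _≤_; _<_)
open import Data.Product using (Σ; _×_; _,_; ∃; proj₁; proj₂)
open import Data.Sum using (_⊎_)
open import Data.Empty using (⊥)
open import Data.List using (List; []; _∷_; length; applyUpTo)
open import Data.List.Membership.Propositional using (_∈_)
open import Data.List.Relation.Unary.Linked using (Linked)
open import Data.List.Relation.Unary.Unique.Propositional using (Unique)
open import Data.List.Relation.Binary.Permutation.Propositional using (_↭_)
open import Relation.Binary.PropositionalEquality using (_≡_; _≢_)
open import Relation.Nullary using (¬_)
open import Function.Bundles using (_⇔_)

Point : Set
Point = ℕ × ℕ

x : Point → ℕ
x = proj₁

y : Point → ℕ
y = proj₂

-- strict lexicographic order on points; a finite set of points is
-- represented canonically as a strictly increasing list of points
_<ₚ_ : Point → Point → Set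
p <ₚ q = (x p < x q) ⊎ ((x p ≡ x q) × (y p < y q))

PointSet : Set
PointSet = List Point

IsCanonical : PointSet → Set
IsCanonical A = Linked _<ₚ_ A

Positive : PointSet → Set
Positive A = ∀ p → p ∈ A → (1 ≤ x p) × (1 ≤ y p)

ColumnsGapless : PointSet → Set
ColumnsGapless A =
  ∀ p → p ∈ A → ∀ x′ → 1 ≤ x′ → x′ < x p → ∃ λ q → (q ∈ A) × (x q ≡ x′)

RowsGapless : PointSet → Set
RowsGapless A =
  ∀ p → p ∈ A → ∀ y′ → 1 ≤ y′ → y′ < y p → ∃ λ q → (q ∈ A) × (y q ≡ y′)

NoAmbiguity : PointSet → Set
NoAmbiguity A =
  ¬ (∃ λ p → ∃ λ q → ∃ λ s → (p ∈ A) × (q ∈ A) × (s ∈ A)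
       × (x q ≡ x p) × (y q < y p) × (y s ≡ y p) × (x s < x p))

IsNAF : PointSet → Set
IsNAF A = IsCanonical A × Positive A × ColumnsGapless A × RowsGapless A × NoAmbiguity A

Below : PointSet → Point → Point → Set
Below A p q = (q ∈ A) × (x q ≡ x p) × (y q < y p)

LeftOf : PointSet → Point → Point → Set
LeftOf A p q = (q ∈ A) × (y q ≡ y p) × (x q < x p)

Parent : PointSet → Point → Point → Set
Parent A q p =
  (p ∈ A) ×
  ( (Below A p q × (∀ q′ → Below A p q′ → y q′ ≤ y q))
  ⊎ ((¬ (∃ λ q′ → Below A p q′)) × LeftOf A p q × (∀ s → LeftOf A p s → x s ≤ x q)))

IsLeaf : PointSet → Point → Set
IsLeaf A q = ∀ p → ¬ Parent A q p

HasZeroOrTwoChildren : PointSet → Point → Set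
HasZeroOrTwoChildren A q =
  IsLeaf A q ⊎
  (∃ λ c₁ → ∃ λ c₂ → (c₁ ≢ c₂) × Parent A q c₁ × Parent A q c₂
     × (∀ p → Parent A q p → (p ≡ c₁) ⊎ (p ≡ c₂)))

IsComplete : PointSet → Set
IsComplete A = ∀ q → q ∈ A → HasZeroOrTwoChildren A q

NumLeaves : PointSet → ℕ → Set
NumLeaves A n =
  ∃ λ (L : List Point) → Unique L × (∀ p → (p ∈ L) ⇔ ((p ∈ A) × IsLeaf A p)) × (length L ≡ n)

IsCNAF : ℕ → PointSet → Set
IsCNAF n A = IsNAF A × IsComplete A × NumLeaves A n

-- Permutations of {1,…,n} in one-line notation, and common rises

IsPerm : ℕ → List ℕ → Set
IsPerm n α = α ↭ applyUpTo suc n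

data CommonRise : List ℕ → List ℕ → Set where
  here  : ∀ {a a′ b b′ α β} → a < a′ → b < b′ →
          CommonRise (a ∷ a′ ∷ α) (b ∷ b′ ∷ β)
  there : ∀ {a b α β} → CommonRise α β → CommonRise (a ∷ α) (b ∷ β)

IsPermPairNoCommonRise : ℕ → List ℕ × List ℕ → Set
IsPermPairNoCommonRise n (α , β) = IsPerm n α × IsPerm n β × ¬ CommonRise α β

-- Bijection between two subsets {a | P a} ⊆ A and {b | Q b} ⊆ B,
-- where elements are compared by propositional equality of the carrier

BijectionBetween : {A B : Set} → (A → Set) → (B → Set) → Set
BijectionBetween {A} {B} P Q =
  ∃ λ (f : A → B) →
    (∀ a → P a → Q (f a)) ×
    (∀ a a′ → P a → P a′ → f a ≡ f a′ → a ≡ a′) ×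
    (∀ b → Q b → ∃ λ a → P a × (f a ≡ b))

{-# OPTIONS --safe #-}

-- In a complete non-ambiguous forest the children of a point are the next point above it and the
-- next point to its right, and a point has either both or none.  So every row and every column
-- ends in exactly one leaf: the leaves form a permutation matrix, and an internal point is
-- recovered as (least column, least row) of the leaves of its subtree.
--
-- The pair of permutations lists the leaves in a suitable order.  A tree reached by an up-edge (or
-- a whole tree of the forest) lists its up-subtree before its right-subtree; a tree reached by a
-- right-edge does the opposite.  The first kind of word starts at its least column, the second at
-- its least row, so the concatenations create no common rise.  The trees of the forest are listed
-- by decreasing column of the root, for the same reason.
--
-- Conversely, a word without common rise that starts at its least column and has at least two
-- letters cannot also start at its least row; cutting it before its least row gives a word of the
-- first kind and one of the second.  An arbitrary word is cut before its least column repeatedly.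
module Submission where

open import Defs
open import Data.Nat using (ℕ; zero; suc; _+_; _≤_; _<_; z≤n; s≤s)
open import Data.Nat.Properties
open import Data.Nat.ListAction using (sum)
open import Data.Product using (_×_; _,_; ∃; proj₁; proj₂)
open import Data.Sum using (_⊎_; inj₁; inj₂; [_,_]′)
open import Data.Unit using (⊤; tt)
open import Data.Empty using (⊥; ⊥-elim)
open import Data.List using (List; []; _∷_; _++_; map; filter; length; concatMap; applyUpTo; zip)
open import Data.List.Properties using (∷-injectiveˡ; ∷-injectiveʳ; length-++; length-map; length-applyUpTo)
open import Data.List.Membership.Propositional using (_∈_; find; lose)
open import Data.List.Membership.Propositional.Properties using (∈-++⁺ˡ; ∈-++⁺ʳ; ∈-++⁻; ∈-map⁺; ∈-map⁻; ∈-filter⁺; ∈-filter⁻; ∈-concatMap⁺; ∈-concatMap⁻; ∈-applyUpTo⁺; ∈-applyUpTo⁻)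
open import Data.List.Membership.Propositional.Properties.WithK using (unique∧set⇒bag)
open import Data.List.Relation.Binary.BagAndSetEquality using (∼bag⇒↭)
open import Data.List.Relation.Binary.Permutation.Propositional using (_↭_; ↭-sym; ↭⇒↭ₛ)
open import Data.List.Relation.Binary.Permutation.Propositional.Properties using (∈-resp-↭; ↭-length)
import Data.List.Relation.Binary.Permutation.Setoid.Properties as Permutation
open import Data.List.Relation.Unary.All as All using (All; []; _∷_)
import Data.List.Relation.Unary.All.Properties as All
open import Data.List.Relation.Unary.Any using (here; there)
open import Data.List.Relation.Unary.AllPairs as AllPairs using (AllPairs; []; _∷_)
import Data.List.Relation.Unary.AllPairs.Properties as AllPairs
open import Data.List.Relation.Unary.Linked as Linked using (Linked; []; [-]; _∷_)
open import Data.List.Relation.Unary.Linked.Properties using (AllPairs⇒Linked; Linked⇒AllPairs)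
open import Data.List.Relation.Unary.Unique.Propositional using (Unique)
open import Data.List.Relation.Unary.Unique.Propositional.Properties using (applyUpTo⁺₁)
open import Function.Base using (_∘_)
open import Function.Bundles using (_⇔_; mk⇔; Equivalence)
open import Relation.Binary.Definitions using (tri<; tri≈; tri>)
open import Relation.Binary.PropositionalEquality using (_≡_; _≢_; refl; sym; trans; cong; cong₂; subst; subst₂; setoid)
open import Relation.Nullary using (¬_; Dec; yes; no)
open import Relation.Nullary.Decidable using (_×-dec_)
open import Function.Construct.Identity using (⇔-id)
open import Function.Construct.Composition using (_⇔-∘_)

private
  variable
    A A′ : PointSet
    p q s : Point

-- Lists

module _ {X : Set} {R S : X → X → Set} where

  AllPairs-map∈ : ∀ {xs} → (∀ {a b} → a ∈ xs → b ∈ xs → R a b → S a b) →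
                  AllPairs R xs → AllPairs S xs
  AllPairs-map∈ f []         = []
  AllPairs-map∈ f (rx ∷ rxs) =
    All.tabulate (λ b∈ → f (here refl) (there b∈) (All.lookup rx b∈)) ∷
    AllPairs-map∈ (λ a∈ b∈ → f (there a∈) (there b∈)) rxs

module _ {X : Set} {R : X → X → Set} where

  AllPairs-++⁻ : ∀ xs {ys} → AllPairs R (xs ++ ys) →
                 AllPairs R xs × AllPairs R ys × (∀ {a b} → a ∈ xs → b ∈ ys → R a b)
  AllPairs-++⁻ []       rs       = [] , rs , λ ()
  AllPairs-++⁻ (a ∷ xs) (ra ∷ rs) with AllPairs-++⁻ xs rs
  ... | rxs , rys , cross =
    All.++⁻ˡ xs ra ∷ rxs , rys ,
    λ { (here refl) b∈ → All.lookup (All.++⁻ʳ xs ra) b∈ ; (there a∈) b∈ → cross a∈ b∈ }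

  AllPairs-++⁺ : ∀ {xs ys} → AllPairs R xs → AllPairs R ys →
                 (∀ {a b} → a ∈ xs → b ∈ ys → R a b) → AllPairs R (xs ++ ys)
  AllPairs-++⁺ rxs rys cross =
    AllPairs.++⁺ rxs rys (All.tabulate λ a∈ → All.tabulate λ b∈ → cross a∈ b∈)

  AllPairs-lookup : ∀ {xs a b} → AllPairs R xs → a ∈ xs → b ∈ xs → a ≡ b ⊎ R a b ⊎ R b a
  AllPairs-lookup (_  ∷ _)  (here refl) (here refl) = inj₁ refl
  AllPairs-lookup (ra ∷ _)  (here refl) (there b∈)  = inj₂ (inj₁ (All.lookup ra b∈))
  AllPairs-lookup (rb ∷ _)  (there a∈)  (here refl) = inj₂ (inj₂ (All.lookup rb a∈))
  AllPairs-lookup (_  ∷ rs) (there a∈)  (there b∈)  = AllPairs-lookup rs a∈ b∈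

  Linked-++⁺ : ∀ {xs h ys} → Linked R xs → (∀ {a} → a ∈ xs → R a h) →
               Linked R (h ∷ ys) → Linked R (xs ++ h ∷ ys)
  Linked-++⁺ []        _   rys = rys
  Linked-++⁺ [-]       Rxh rys = Rxh (here refl) ∷ rys
  Linked-++⁺ (r ∷ rxs) Rxh rys = r ∷ Linked-++⁺ rxs (Rxh ∘ there) rys

  Linked-++⁻ : ∀ xs {ys} → Linked R (xs ++ ys) → Linked R xs × Linked R ys
  Linked-++⁻ []           rs       = [] , rs
  Linked-++⁻ (_ ∷ [])     rs       = [-] , Linked.tail rs
  Linked-++⁻ (_ ∷ b ∷ xs) (r ∷ rs) with Linked-++⁻ (b ∷ xs) rs
  ... | rxs , rys = r ∷ rxs , rys

  -- If the heads differed, each would occur in the tail of the other list, and `R` would hold both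
  -- ways between them. Both canonical point sets and lists of trees are identified in this way.
  AllPairs-unique : (∀ {a b} → R a b → R b a → ⊥) → ∀ {xs ys} → AllPairs R xs → AllPairs R ys →
                    (∀ {a} → a ∈ xs → a ∈ ys) → (∀ {a} → a ∈ ys → a ∈ xs) → xs ≡ ys
  AllPairs-unique asym {[]}    {[]}    _ _ _   _   = refl
  AllPairs-unique asym {[]}    {_ ∷ _} _ _ _   sup with () ← sup (here refl)
  AllPairs-unique asym {_ ∷ _} {[]}    _ _ sub _   with () ← sub (here refl)
  AllPairs-unique asym {a ∷ xs} {b ∷ ys} (ra ∷ rxs) (rb ∷ rys) sub sup = step a≡b
    where
    a≡b : a ≡ b
    a≡b with sub (here refl) | sup (here refl)
    ... | here eq  | _        = eq
    ... | there _  | here eq  = sym eq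
    ... | there a∈ | there b∈ = ⊥-elim (asym (All.lookup ra b∈) (All.lookup rb a∈))
    step : a ≡ b → a ∷ xs ≡ b ∷ ys
    step refl = cong (a ∷_) (AllPairs-unique asym rxs rys sub′ sup′)
      where
      sub′ : ∀ {v} → v ∈ xs → v ∈ ys
      sub′ v∈ with sub (there v∈)
      ... | here refl = ⊥-elim (asym (All.lookup ra v∈) (All.lookup ra v∈))
      ... | there v∈′ = v∈′
      sup′ : ∀ {v} → v ∈ ys → v ∈ xs
      sup′ v∈ with sup (there v∈)
      ... | here refl = ⊥-elim (asym (All.lookup rb v∈) (All.lookup rb v∈))
      ... | there v∈′ = v∈′

Unique-set⇒↭ : ∀ {X : Set} {xs ys : List X} → Unique xs → Unique ys →
               (∀ {a} → a ∈ xs → a ∈ ys) → (∀ {a} → a ∈ ys → a ∈ xs) → xs ↭ ys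
Unique-set⇒↭ uxs uys sub sup = ∼bag⇒↭ (unique∧set⇒bag uxs uys (mk⇔ sub sup))

Unique-applyUpTo-suc : ∀ n → Unique (applyUpTo suc n)
Unique-applyUpTo-suc n = applyUpTo⁺₁ suc n (λ i<j _ eq → <⇒≢ i<j (suc-injective eq))

module _ {X : Set} {P : X → Set} (P? : ∀ a → Dec (P a)) {_≼_ : X → X → Set}
         (total : ∀ a b → a ≼ b ⊎ b ≼ a) (≼-trans : ∀ {a b c} → a ≼ b → b ≼ c → a ≼ c) where

  -- The order is a parameter so that the reversed order yields a greatest element. Searches for the
  -- next and for the previous point on a line are both instances.
  least : ∀ xs → (∃ λ a → a ∈ xs × P a × (∀ {b} → b ∈ xs → P b → a ≼ b)) ⊎ (∀ {a} → a ∈ xs → ¬ P a)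
  least [] = inj₂ λ ()
  least (e ∷ xs) with P? e | least xs
  ... | no ¬Pe | inj₂ none = inj₂ λ { (here refl) → ¬Pe ; (there a∈) → none a∈ }
  ... | no ¬Pe | inj₁ (a , a∈ , Pa , min) =
    inj₁ (a , there a∈ , Pa , λ { (here refl) Pe → ⊥-elim (¬Pe Pe) ; (there b∈) → min b∈ })
  ... | yes Pe | inj₂ none =
    inj₁ (e , here refl , Pe ,
          λ { (here refl) _ → [ (λ r → r) , (λ r → r) ]′ (total e e)
            ; (there b∈) Pb → ⊥-elim (none b∈ Pb) })
  ... | yes Pe | inj₁ (a , a∈ , Pa , min) with total e a
  ...   | inj₁ e≼a =
    inj₁ (e , here refl , Pe ,
          λ { (here refl) _ → [ (λ r → r) , (λ r → r) ]′ (total e e)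
            ; (there b∈) Pb → ≼-trans e≼a (min b∈ Pb) })
  ...   | inj₂ a≼e =
    inj₁ (a , there a∈ , Pa , λ { (here refl) _ → a≼e ; (there b∈) → min b∈ })

-- With `m` the largest entry, positivity and closure downwards give `xs` exactly the members of
-- `1, …, m`. Both lists are duplicate-free, so they are permutations of each other and `m` is the
-- length.
gapless⇒↭ : ∀ {xs} → Unique xs → (∀ {v} → v ∈ xs → 1 ≤ v) →
            (∀ {v} → v ∈ xs → ∀ {i} → 1 ≤ i → i < v → i ∈ xs) → xs ↭ applyUpTo suc (length xs)
gapless⇒↭ {xs} uxs pos closed
  with least {P = λ _ → ⊤} (λ _ → yes tt) {λ a b → b ≤ a} (λ a b → ≤-total b a) (λ p q → ≤-trans q p) xs
... | inj₂ none = Unique-set⇒↭ uxs (Unique-applyUpTo-suc _) (λ v∈ → ⊥-elim (none v∈ tt)) (empty xs none)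
  where
  empty : ∀ xs → (∀ {a} → a ∈ xs → ¬ ⊤) → ∀ {v} → v ∈ applyUpTo suc (length xs) → v ∈ xs
  empty []      _    ()
  empty (_ ∷ _) none _ = ⊥-elim (none (here refl) tt)
... | inj₁ (m , m∈ , _ , max) = subst (λ l → xs ↭ applyUpTo suc l) (sym len) xs↭
  where
  sub : ∀ {v} → v ∈ xs → v ∈ applyUpTo suc m
  sub {zero}  v∈ with () ← pos v∈
  sub {suc v} v∈ = ∈-applyUpTo⁺ suc (max v∈ tt)
  sup : ∀ {v} → v ∈ applyUpTo suc m → v ∈ xs
  sup v∈ with ∈-applyUpTo⁻ suc v∈
  ... | i , i<m , refl with m≤n⇒m<n∨m≡n i<m
  ...   | inj₁ lt   = closed m∈ (s≤s z≤n) lt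
  ...   | inj₂ refl = m∈
  xs↭ : xs ↭ applyUpTo suc m
  xs↭ = Unique-set⇒↭ uxs (Unique-applyUpTo-suc m) sub sup
  len : length xs ≡ m
  len = trans (↭-length xs↭) (length-applyUpTo suc m)

module _ {X : Set} (key : X → ℕ) where

  cut-at-min : ∀ e xs → AllPairs (λ a b → key a ≢ key b) (e ∷ xs) →
               ∃ λ ys → ∃ λ h → ∃ λ zs → e ∷ xs ≡ ys ++ h ∷ zs ×
                 (∀ {a} → a ∈ ys → key h < key a) × (∀ {a} → a ∈ zs → key h < key a)
  cut-at-min e []       _ = [] , e , [] , refl , (λ ()) , λ ()
  cut-at-min e (b ∷ xs) (e≢ ∷ xs≢) with cut-at-min b xs xs≢
  ... | ys , h , zs , eq , ys> , zs> with <-cmp (key h) (key e)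
  ...   | tri< h<e _ _ = e ∷ ys , h , zs , cong (e ∷_) eq ,
                         (λ { (here refl) → h<e ; (there a∈) → ys> a∈ }) , zs>
  ...   | tri≈ _ h≡e _ = ⊥-elim (All.lookup e≢ (subst (h ∈_) (sym eq) (∈-++⁺ʳ ys (here refl))) (sym h≡e))
  ...   | tri> _ _ e<h = [] , e , b ∷ xs , refl , (λ ()) , above
    where
    above : ∀ {a} → a ∈ b ∷ xs → key e < key a
    above a∈ with ∈-++⁻ ys (subst (_ ∈_) eq a∈)
    ... | inj₁ a∈ys         = <-trans e<h (ys> a∈ys)
    ... | inj₂ (here refl)  = e<h
    ... | inj₂ (there a∈zs) = <-trans e<h (zs> a∈zs)

  -- In the common word, `h` is the first letter whose key is not above `m`, so the place of the cut
  -- depends on the word and `m` alone.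
  cut-unique : ∀ {m xs xs′ h h′ ys ys′} →
               (∀ {a} → a ∈ xs → m < key a) → (∀ {a} → a ∈ xs′ → m < key a) →
               key h ≡ m → key h′ ≡ m → xs ++ h ∷ ys ≡ xs′ ++ h′ ∷ ys′ →
               xs ≡ xs′ × h ∷ ys ≡ h′ ∷ ys′
  cut-unique {xs = []}    {[]}    _ _ _ _ eq = refl , eq
  cut-unique {xs = []}    {_ ∷ _} _ xs′> h≡m _ refl = ⊥-elim (<-irrefl (sym h≡m) (xs′> (here refl)))
  cut-unique {xs = _ ∷ _} {[]}    xs> _ _ h′≡m refl = ⊥-elim (<-irrefl (sym h′≡m) (xs> (here refl)))
  cut-unique {xs = _ ∷ _} {_ ∷ _} xs> xs′> h≡m h′≡m eq
    with refl ← ∷-injectiveˡ eq | xs≡ , ys≡ ← cut-unique (xs> ∘ there) (xs′> ∘ there) h≡m h′≡m (∷-injectiveʳ eq)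
    = cong (_ ∷_) xs≡ , ys≡

cut-length : ∀ {X : Set} {xs zs : List X} {h} ys {k} → xs ≡ ys ++ h ∷ zs →
             length xs ≤ suc k → length ys + length zs ≤ k
cut-length {zs = zs} ys refl len =
  ≤-pred (≤-trans (≤-reflexive (trans (sym (+-suc (length ys) (length zs))) (sym (length-++ ys)))) len)

-- Binary trees on points

data Dir : Set where
  up right : Dir

opp : Dir → Dir
opp up    = right
opp right = up

-- c d is the coordinate that stays constant when moving in direction d.
c : Dir → Point → ℕ
c up    = x
c right = y

same-or-opp : ∀ d e → d ≡ e ⊎ d ≡ opp e
same-or-opp up    up    = inj₁ refl
same-or-opp up    right = inj₂ refl
same-or-opp right up    = inj₂ refl
same-or-opp right right = inj₁ refl

point-ext : ∀ d → c d p ≡ c d q → c (opp d) p ≡ c (opp d) q → p ≡ q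
point-ext up    x≡ y≡ = cong₂ _,_ x≡ y≡
point-ext right y≡ x≡ = cong₂ _,_ x≡ y≡

data Tree : Set where
  leaf : Point → Tree
  node : Tree → Tree → Tree

root : Tree → Point
root (leaf p)   = p
root (node u r) = x (root u) , y (root r)

kid : Dir → Tree → Tree → Tree
kid up    u r = u
kid right u r = r

private
  variable
    t t′ u r : Tree

root-kid : ∀ d u r → c d (root (node u r)) ≡ c d (root (kid d u r))
root-kid up    _ _ = refl
root-kid right _ _ = refl

data _∈ᵗ_ (p : Point) : Tree → Set where
  at-root : p ≡ root t → p ∈ᵗ t
  in-kid  : ∀ d → p ∈ᵗ kid d u r → p ∈ᵗ node u r

root∈ : root t ∈ᵗ t
root∈ = at-root refl

-- By `root-kid`, the inequality for `up` says that the right kid lies strictly to the right of the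
-- root, and the one for `right` that the up kid lies strictly above it.
data Heap : Tree → Set where
  leaf : Heap (leaf p)
  node : (∀ d → Heap (kid d u r)) →
         (∀ d → c d (root (kid d u r)) < c d (root (kid (opp d) u r))) → Heap (node u r)

root<kid : ∀ d → Heap (node u r) → c (opp d) (root (node u r)) < c (opp d) (root (kid d u r))
root<kid up    (node _ lt) = lt right
root<kid right (node _ lt) = lt up

root-min : Heap t → p ∈ᵗ t → ∀ d → c d (root t) ≤ c d p
root-min _ (at-root refl) d = ≤-refl
root-min h@(node {u = u} {r} hs _) (in-kid e p∈) d = ≤-trans (root≤kid (same-or-opp d e)) (root-min (hs e) p∈ d)
  where
  root≤kid : d ≡ e ⊎ d ≡ opp e → c d (root (node u r)) ≤ c d (root (kid e u r))
  root≤kid (inj₁ refl) = ≤-reflexive (root-kid d u r)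
  root≤kid (inj₂ refl) = <⇒≤ (root<kid e h)

Apart : Tree → Tree → Set
Apart t t′ = ∀ {p q} d → p ∈ᵗ t → q ∈ᵗ t′ → c d p ≢ c d q

data Separated : Tree → Set where
  leaf : Separated (leaf p)
  node : (∀ d → Separated (kid d u r)) → Apart u r → Separated (node u r)

kids-apart : Apart u r → ∀ d → Apart (kid d u r) (kid (opp d) u r)
kids-apart ap up    e p∈ q∈ = ap e p∈ q∈
kids-apart ap right e p∈ q∈ = ap e q∈ p∈ ∘ sym

-- The words of leaves

word : Dir → Tree → List Point
word d     (leaf p)   = p ∷ []
word up    (node u r) = word up u ++ word right r
word right (node u r) = word right r ++ word up u

word-node : ∀ d u r → word d (node u r) ≡ word d (kid d u r) ++ word (opp d) (kid (opp d) u r)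
word-node up    _ _ = refl
word-node right _ _ = refl

word-kid⁺ : ∀ d e → p ∈ word e (kid e u r) → p ∈ word d (node u r)
word-kid⁺         up    up    p∈ = ∈-++⁺ˡ p∈
word-kid⁺ {u = u} up    right p∈ = ∈-++⁺ʳ (word up u) p∈
word-kid⁺ {r = r} right up    p∈ = ∈-++⁺ʳ (word right r) p∈
word-kid⁺         right right p∈ = ∈-++⁺ˡ p∈

word-kid⁻ : ∀ d u r → p ∈ word d (node u r) → ∃ λ e → p ∈ word e (kid e u r)
word-kid⁻ up    u r p∈ = [ (up ,_) , (right ,_) ]′ (∈-++⁻ (word up u) p∈)
word-kid⁻ right u r p∈ = [ (right ,_) , (up ,_) ]′ (∈-++⁻ (word right r) p∈)

word⊆ : ∀ d t → p ∈ word d t → p ∈ᵗ t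
word⊆ d (leaf _)   (here refl) = root∈
word⊆ d (node u r) p∈ with word-kid⁻ d u r p∈
... | up    , p∈u = in-kid up    (word⊆ up u p∈u)
... | right , p∈r = in-kid right (word⊆ right r p∈r)

-- Descending always in direction `d` keeps the coordinate `c d` fixed and ends in a leaf. The
-- direction `e` only affects the order of the word, not its letters.
leaf-on-root-line : ∀ d e t → ∃ λ l → l ∈ word e t × c d l ≡ c d (root t)
leaf-on-root-line d e (leaf p) = p , here refl , refl
leaf-on-root-line up e (node u r) with leaf-on-root-line up up u
... | l , l∈ , eq = l , word-kid⁺ e up l∈ , eq
leaf-on-root-line right e (node u r) with leaf-on-root-line right right r
... | l , l∈ , eq = l , word-kid⁺ e right l∈ , eq

leaf-on-line : ∀ d e → p ∈ᵗ t → ∃ λ l → l ∈ word e t × c d l ≡ c d p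
leaf-on-line {t = t} d e (at-root refl) = leaf-on-root-line d e t
leaf-on-line d e (in-kid k p∈) with leaf-on-line d k p∈
... | l , l∈ , eq = l , word-kid⁺ e k l∈ , eq

-- The first factor of `word d` is the word of the kid in direction `d`, read again in direction
-- `d`, and that kid shares `c d` with its parent.
word-head : ∀ d t → ∃ λ h → ∃ λ w → word d t ≡ h ∷ w × c d h ≡ c d (root t)
word-head d     (leaf p)   = p , [] , refl , refl
word-head up    (node u r) with word-head up u
... | h , w , eq , ch = h , w ++ word right r , cong (_++ word right r) eq , ch
word-head right (node u r) with word-head right r
... | h , w , eq , ch = h , w ++ word up u , cong (_++ word up u) eq , ch

Step : Point → Point → Set
Step p q = ¬ (x p < x q × y p < y q)

fall⇒Step : ∀ d → c d q < c d p → Step p q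
fall⇒Step up    q<p (p<q , _) = <-asym q<p p<q
fall⇒Step right q<p (_ , p<q) = <-asym q<p p<q

Differ : Point → Point → Set
Differ p q = ∀ d → c d p ≢ c d q

-- The only new adjacent pair ends in the first letter of `word d t`, where `c d` takes its value at
-- the root; this coordinate falls there, so the pair is no common rise.
append-word : ∀ {w} d t → Linked Step w → (∀ {p} → p ∈ w → c d (root t) < c d p) →
              Linked Step (word d t) → Linked Step (w ++ word d t)
append-word d t sw fall st with word d t | word-head d t
... | _ | h , w′ , refl , ch = Linked-++⁺ sw (λ p∈ → fall⇒Step d (subst (_< _) (sym ch) (fall p∈))) st

word-steps : ∀ d → Heap t → Linked Step (word d t)
word-steps d leaf = [-]
word-steps d h@(node {u = u} {r} hs lt) =
  subst (Linked Step) (sym (word-node d u r))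
    (append-word (opp d) (kid (opp d) u r) (word-steps d (hs d))
      (λ p∈ → <-≤-trans fall (root-min (hs d) (word⊆ d (kid d u r) p∈) (opp d)))
      (word-steps (opp d) (hs (opp d))))
  where
  fall : c (opp d) (root (kid (opp d) u r)) < c (opp d) (root (kid d u r))
  fall = subst (_< c (opp d) (root (kid d u r))) (root-kid (opp d) u r) (root<kid d h)

word-distinct : ∀ d → Separated t → AllPairs Differ (word d t)
word-distinct d leaf = [] ∷ []
word-distinct d (node {u = u} {r} ss ap) =
  subst (AllPairs Differ) (sym (word-node d u r))
    (AllPairs-++⁺ (word-distinct d (ss d)) (word-distinct (opp d) (ss (opp d)))
      λ p∈ q∈ e → kids-apart ap d e (word⊆ d (kid d u r) p∈) (word⊆ (opp d) (kid (opp d) u r) q∈))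

word≢singleton : ∀ d u r → word d (node u r) ≢ p ∷ []
word≢singleton d u r eq
  with word d (kid d u r) | word-head d (kid d u r) | word (opp d) (kid (opp d) u r) | word-head (opp d) (kid (opp d) u r) | trans (sym (word-node d u r)) eq
... | _ | _ , []    , refl , _ | _ | _ , _ , refl , _ | ()
... | _ | _ , _ ∷ _ , refl , _ | _ | _ , _ , refl , _ | ()

-- Some leaf of `t` attains `c e (root t)`, and it is also a leaf of `t′`, whose root is minimal.
-- Applied both ways, this shows that the word determines the root.
word-root≤ : ∀ d e t → Heap t′ → word d t ≡ word d t′ → c e (root t′) ≤ c e (root t)
word-root≤ d e t h′ eq with leaf-on-root-line e d t
... | l , l∈ , cl = subst (_ ≤_) cl (root-min h′ (word⊆ d _ (subst (l ∈_) eq l∈)) e)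

-- The boundary between the two factors is found at the minimum of the opposite coordinate.
word-injective : ∀ d t t′ → Heap t → Heap t′ → word d t ≡ word d t′ → t ≡ t′
word-injective d (leaf p)   (leaf q)     _ _ eq = cong leaf (∷-injectiveˡ eq)
word-injective d (leaf p)   (node u r)   _ _ eq = ⊥-elim (word≢singleton d u r (sym eq))
word-injective d (node u r) (leaf q)     _ _ eq = ⊥-elim (word≢singleton d u r eq)
word-injective d t@(node u r) t′@(node u′ r′) h@(node hs lt) h′@(node hs′ lt′) eq =
  join d (ih d (kid d u′ r′) (hs d) (hs′ d) (proj₁ factors))
         (ih (opp d) (kid (opp d) u′ r′) (hs (opp d)) (hs′ (opp d)) (proj₂ factors))
  where
  ih : ∀ e t″ → Heap (kid e u r) → Heap t″ → word e (kid e u r) ≡ word e t″ → kid e u r ≡ t″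
  ih up    = word-injective up u
  ih right = word-injective right r
  join : ∀ e → kid e u r ≡ kid e u′ r′ → kid (opp e) u r ≡ kid (opp e) u′ r′ → t ≡ t′
  join up    refl refl = refl
  join right refl refl = refl
  m≡ : c (opp d) (root t) ≡ c (opp d) (root t′)
  m≡ = ≤-antisym (word-root≤ d (opp d) t′ h (sym eq)) (word-root≤ d (opp d) t h′ eq)
  factors : word d (kid d u r) ≡ word d (kid d u′ r′) ×
            word (opp d) (kid (opp d) u r) ≡ word (opp d) (kid (opp d) u′ r′)
  factors with word-head (opp d) (kid (opp d) u r) | word-head (opp d) (kid (opp d) u′ r′)
  ... | h₁ , w₁ , e₁ , c₁ | h₂ , w₂ , e₂ , c₂
    with cut-unique (c (opp d)) {m = c (opp d) (root t)}
           (λ a∈ → <-≤-trans (root<kid d h) (root-min (hs d) (word⊆ d _ a∈) (opp d)))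
           (λ a∈ → subst (_< _) (sym m≡) (<-≤-trans (root<kid d h′) (root-min (hs′ d) (word⊆ d _ a∈) (opp d))))
           (trans c₁ (sym (root-kid (opp d) u r)))
           (trans c₂ (trans (sym (root-kid (opp d) u′ r′)) (sym m≡)))
           (trans (cong (word d (kid d u r) ++_) (sym e₁))
             (trans (sym (word-node d u r)) (trans eq (trans (word-node d u′ r′)
               (cong (word d (kid d u′ r′) ++_) e₂)))))
  ...   | ws≡ , hs≡ = ws≡ , trans e₁ (trans hs≡ (sym e₂))

-- Every line that meets a tree contains a leaf of that tree, so a line common to two trees yields
-- two leaves on it.
Apart-words : ∀ d e → (∀ {p q} → p ∈ word d t → q ∈ word e t′ → Differ p q) → Apart t t′
Apart-words d e differ k p∈ q∈ with leaf-on-line k d p∈ | leaf-on-line k e q∈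
... | l , l∈ , lp | m , m∈ , mq = λ eq → differ l∈ m∈ k (trans lp (trans eq (sym mq)))

-- Trees built from words without common rise

IsTreeWord : Dir → List Point → Tree → Set
IsTreeWord d w t = Heap t × Separated t × word d t ≡ w

graft : ∀ {v w} d t₁ t₂ → IsTreeWord d v t₁ → IsTreeWord (opp d) w t₂ →
        (∀ {p q} → p ∈ v → q ∈ w → Differ p q) →
        c d (root t₁) < c d (root t₂) → c (opp d) (root t₂) < c (opp d) (root t₁) →
        ∃ (IsTreeWord d (v ++ w))
graft up t₁ t₂ (h₁ , s₁ , refl) (h₂ , s₂ , refl) differ lt₁ lt₂ =
  node t₁ t₂ ,
  node (λ { up → h₁ ; right → h₂ }) (λ { up → lt₁ ; right → lt₂ }) ,
  node (λ { up → s₁ ; right → s₂ }) (Apart-words up right differ) , refl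
graft right t₁ t₂ (h₁ , s₁ , refl) (h₂ , s₂ , refl) differ lt₁ lt₂ =
  node t₂ t₁ ,
  node (λ { up → h₂ ; right → h₁ }) (λ { up → lt₂ ; right → lt₁ }) ,
  node (λ { up → s₂ ; right → s₁ }) (Apart-words up right (λ p∈ q∈ d eq → differ q∈ p∈ d (sym eq))) , refl

root∈word : ∀ {w} d e → IsTreeWord e w t → ∃ λ l → l ∈ w × c d l ≡ c d (root t)
root∈word {t} d e (_ , _ , refl) = leaf-on-root-line d e t

root-head : ∀ {h w} d → IsTreeWord d (h ∷ w) t → c d h ≡ c d (root t)
root-head {t} d (_ , _ , eq) with word-head d t
... | h , w , eq′ , ch = trans (cong (c d) (∷-injectiveˡ (trans (sym eq) eq′))) ch

-- Were the first letter minimal in both coordinates, the first step would be a common rise.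
head-not-min : ∀ {h e w} d → c d h < c d e → Step h e → (∀ {q} → q ∈ e ∷ w → c (opp d) h < c (opp d) q) → ⊥
head-not-min up    h<e st min = st (h<e , min (here refl))
head-not-min right h<e st min = st (min (here refl) , h<e)

tree-of-word : ∀ k d h w → length w ≤ k → (∀ {q} → q ∈ w → c d h < c d q) →
               AllPairs Differ (h ∷ w) → Linked Step (h ∷ w) → ∃ (IsTreeWord d (h ∷ w))
-- This is split off so that the cut arrives as separate equations for head and tail, each matched
-- by `refl`. The fuel bounds the letters after the first: the second factor starts at `g`, which
-- accounts for the decrease.
tree-of-cut : ∀ k d {h h′ w ys g zs} → h ≡ h′ → w ≡ ys ++ g ∷ zs →
              (∀ {q} → q ∈ h′ ∷ ys → c (opp d) g < c (opp d) q) →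
              (∀ {q} → q ∈ zs → c (opp d) g < c (opp d) q) →
              length w ≤ suc k → (∀ {q} → q ∈ w → c d h < c d q) →
              AllPairs Differ (h ∷ w) → Linked Step (h ∷ w) → ∃ (IsTreeWord d (h ∷ w))

tree-of-word k       d h []      _   _   _  _  = leaf h , leaf , leaf , refl
tree-of-word (suc k) d h (e ∷ w) len min df st
  with cut-at-min (c (opp d)) h (e ∷ w) (AllPairs.map (λ f → f (opp d)) df)
... | [] , _ , _ , refl , _ , zs> = ⊥-elim (head-not-min d (min (here refl)) (Linked.head st) zs>)
... | _ ∷ ys , g , zs , eq , ys> , zs> =
  tree-of-cut k d (∷-injectiveˡ eq) (∷-injectiveʳ eq) ys> zs> len min df st

tree-of-cut k d {h} {ys = ys} {g} {zs} refl refl ys> zs> len min df st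
  with AllPairs-++⁻ (h ∷ ys) df | Linked-++⁻ (h ∷ ys) st
     | cut-length ys refl len
... | df₁ , df₂ , cross | st₁ , st₂ | len′
  with tree-of-word k d h ys (≤-trans (m≤m+n _ _) len′) (min ∘ ∈-++⁺ˡ) df₁ st₁
     | tree-of-word k (opp d) g zs (≤-trans (m≤n+m _ (length ys)) len′) zs> df₂ st₂
... | t₁ , T₁ | t₂ , T₂ = graft d t₁ t₂ T₁ T₂ cross lt₁ lt₂
  where
  lt₁ : c d (root t₁) < c d (root t₂)
  lt₁ with root∈word d (opp d) T₂
  ... | l , l∈ , eq = subst₂ _<_ (root-head d T₁) eq (min (∈-++⁺ʳ ys l∈))
  lt₂ : c (opp d) (root t₂) < c (opp d) (root t₁)
  lt₂ with root∈word (opp d) d T₁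
  ... | l , l∈ , eq = subst₂ _<_ (root-head (opp d) T₂) eq (ys> l∈)

-- Forests

record Valid (F : List Tree) : Set where
  field
    heaps     : ∀ {t} → t ∈ F → Heap t
    separated : ∀ {t} → t ∈ F → Separated t
    ordered   : AllPairs (λ t t′ → x (root t) < x (root t′)) F
    apart     : AllPairs Apart F

Valid-tail : ∀ {t F} → Valid (t ∷ F) → Valid F
Valid-tail v = record
  { heaps = heaps ∘ there ; separated = separated ∘ there
  ; ordered = AllPairs.tail ordered ; apart = AllPairs.tail apart }
  where open Valid v

-- A valid forest is listed by increasing root column while its word needs decreasing columns, hence
-- the tail comes first. The word of the head tree then begins at the least column of the whole
-- word.
forestWord : List Tree → List Point
forestWord []      = []
forestWord (t ∷ F) = forestWord F ++ word up t

private
  variable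
    F F′ : List Tree

forestWord⁺ : t ∈ F → p ∈ word up t → p ∈ forestWord F
forestWord⁺ {F = _ ∷ F} (here refl) p∈ = ∈-++⁺ʳ (forestWord F) p∈
forestWord⁺             (there t∈)  p∈ = ∈-++⁺ˡ (forestWord⁺ t∈ p∈)

forestWord⁻ : ∀ F → p ∈ forestWord F → ∃ λ t → t ∈ F × p ∈ word up t
forestWord⁻ (t ∷ F) p∈ with ∈-++⁻ (forestWord F) p∈
... | inj₂ p∈t = t , here refl , p∈t
... | inj₁ p∈F with forestWord⁻ F p∈F
...   | t′ , t′∈ , p∈t′ = t′ , there t′∈ , p∈t′

first-root<word : Valid (t ∷ F) → p ∈ forestWord F → x (root t) < x p
first-root<word {F = F} v p∈ with forestWord⁻ F p∈
... | t′ , t′∈ , p∈t′ =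
  <-≤-trans (All.lookup (AllPairs.head ordered) t′∈) (root-min (heaps (there t′∈)) (word⊆ up t′ p∈t′) up)
  where open Valid v

first-root≤word : Valid (t ∷ F) → p ∈ forestWord (t ∷ F) → x (root t) ≤ x p
first-root≤word {F = F} v p∈ with ∈-++⁻ (forestWord F) p∈
... | inj₁ p∈F = <⇒≤ (first-root<word v p∈F)
... | inj₂ p∈t = root-min (Valid.heaps v (here refl)) (word⊆ up _ p∈t) up

forestWord-steps : ∀ F → Valid F → Linked Step (forestWord F)
forestWord-steps []      _ = []
forestWord-steps (t ∷ F) v =
  append-word up t (forestWord-steps F (Valid-tail v)) (first-root<word v) (word-steps up (Valid.heaps v (here refl)))

forestWord-distinct : ∀ F → Valid F → AllPairs Differ (forestWord F)
forestWord-distinct []      _ = []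
forestWord-distinct (t ∷ F) v =
  AllPairs-++⁺ (forestWord-distinct F (Valid-tail v)) (word-distinct up (Valid.separated v (here refl))) cross
  where
  cross : p ∈ forestWord F → q ∈ word up t → Differ p q
  cross p∈ q∈ d eq with forestWord⁻ F p∈
  ... | t′ , t′∈ , p∈t′ =
    All.lookup (AllPairs.head (Valid.apart v)) t′∈ d (word⊆ up t q∈) (word⊆ up t′ p∈t′) (sym eq)

first-root≤ : Valid (t′ ∷ F′) → forestWord (t ∷ F) ≡ forestWord (t′ ∷ F′) → x (root t′) ≤ x (root t)
first-root≤ {t = t} {F} v′ eq with leaf-on-root-line up up t
... | l , l∈ , cl = subst (_ ≤_) cl (first-root≤word v′ (subst (l ∈_) eq (forestWord⁺ {F = t ∷ F} (here refl) l∈)))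

[]≢forestWord : ∀ t F → [] ≢ forestWord (t ∷ F)
[]≢forestWord t F eq with leaf-on-root-line up up t
... | l , l∈ , _ with () ← subst (l ∈_) (sym eq) (forestWord⁺ {F = t ∷ F} (here refl) l∈)

forestWord-injective : ∀ F F′ → Valid F → Valid F′ → forestWord F ≡ forestWord F′ → F ≡ F′
forestWord-injective []      []        _ _ _  = refl
forestWord-injective []      (t ∷ F)   _ _ eq = ⊥-elim ([]≢forestWord t F eq)
forestWord-injective (t ∷ F) []        _ _ eq = ⊥-elim ([]≢forestWord t F (sym eq))
forestWord-injective (t ∷ F) (t′ ∷ F′) v v′ eq with word-head up t | word-head up t′
... | h₁ , w₁ , e₁ , c₁ | h₂ , w₂ , e₂ , c₂
  with cut-unique x {m = x (root t)} (first-root<word v) (subst (_< _) (sym m≡) ∘ first-root<word v′) c₁ (trans c₂ (sym m≡))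
         (trans (cong (forestWord F ++_) (sym e₁)) (trans eq (cong (forestWord F′ ++_) e₂)))
  where
  m≡ : x (root t) ≡ x (root t′)
  m≡ = ≤-antisym (first-root≤ {t = t′} {F′} v (sym eq)) (first-root≤ {t = t} {F} v′ eq)
... | F≡ , t≡ =
  cong₂ _∷_
    (word-injective up t t′ (Valid.heaps v (here refl)) (Valid.heaps v′ (here refl)) (trans e₁ (trans t≡ (sym e₂))))
    (forestWord-injective F F′ (Valid-tail v) (Valid-tail v′) F≡)

IsForestWord : List Point → List Tree → Set
IsForestWord w F = Valid F × forestWord F ≡ w

plant : ∀ {v w t F} → IsForestWord v F → IsTreeWord up w t →
        (∀ {p q} → p ∈ v → q ∈ w → Differ p q) → (∀ {p} → p ∈ v → x (root t) < x p) →
        IsForestWord (v ++ w) (t ∷ F)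
plant {t = t} (v , refl) (h , s , refl) cross root< = record
  { heaps     = λ { (here refl) → h ; (there t∈) → heaps t∈ }
  ; separated = λ { (here refl) → s ; (there t∈) → separated t∈ }
  ; ordered   = All.tabulate before ∷ ordered
  ; apart     = All.tabulate (λ t′∈ → Apart-words up up (λ p∈ q∈ d eq → cross (forestWord⁺ t′∈ q∈) p∈ d (sym eq))) ∷ apart
  } , refl
  where
  open Valid v
  before : ∀ {t′} → t′ ∈ _ → x (root t) < x (root t′)
  before {t′} t′∈ with leaf-on-root-line up up t′
  ... | l , l∈ , cl = subst (_ <_) cl (root< (forestWord⁺ t′∈ l∈))

forest-of-word : ∀ k w → length w ≤ k → AllPairs Differ w → Linked Step w → ∃ (IsForestWord w)
forest-of-word k [] _ _ _ =
  [] , record { heaps = λ () ; separated = λ () ; ordered = [] ; apart = [] } , refl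
forest-of-word (suc k) (e ∷ w) len df st with cut-at-min x e w (AllPairs.map (λ f → f up) df)
... | ys , g , zs , eq , ys> , zs> with cut-length ys eq len
...   | len′ rewrite eq with AllPairs-++⁻ ys df | Linked-++⁻ ys st
...     | df₁ , df₂ , cross | st₁ , st₂
  with forest-of-word k ys (≤-trans (m≤m+n _ _) len′) df₁ st₁
     -- The suffix starts at its least column, so it is the word of one tree; the prefix has only
     -- larger columns and supplies the later trees.
     | tree-of-word (length zs) up g zs ≤-refl zs> df₂ st₂
...       | F , FW | t , TW =
  t ∷ F , plant FW TW cross (λ p∈ → subst (_< _) (root-head up TW) (ys> p∈))

-- Neighbours in a point set

Before : PointSet → Dir → Point → Point → Set
Before A d p q = (q ∈ A) × (c d q ≡ c d p) × (c (opp d) q < c (opp d) p)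

record Next (A : PointSet) (d : Dir) (p q : Point) : Set where
  field
    mem     : q ∈ A
    line    : c d q ≡ c d p
    after   : c (opp d) p < c (opp d) q
    nearest : ∀ {s} → s ∈ A → c d s ≡ c d p → c (opp d) p < c (opp d) s → c (opp d) q ≤ c (opp d) s

Last : PointSet → Dir → Point → Set
Last A d p = ∀ {q} → q ∈ A → c d q ≡ c d p → c (opp d) q ≤ c (opp d) p

Terminal : PointSet → Point → Set
Terminal A p = ∀ d → Last A d p

Initial : PointSet → Point → Set
Initial A p = ∀ d {q} → ¬ Before A d p q

-- A positive form of `NoAmbiguity`: the direction without predecessor is given as data, so that
-- proofs can split on it.
Unambiguous : PointSet → Set
Unambiguous A = ∀ {p} → p ∈ A → ∃ λ d → ∀ {q} → ¬ Before A d p q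

Branching : PointSet → Set
Branching A = ∀ {p} → p ∈ A → Terminal A p ⊎ (∀ d → ∃ (Next A d p))

next? : ∀ A d p → ∃ (Next A d p) ⊎ Last A d p
next? A d p with least (λ q → (c d q ≟ c d p) ×-dec (c (opp d) p <? c (opp d) q))
                       {λ q s → c (opp d) q ≤ c (opp d) s} (λ _ _ → ≤-total _ _) ≤-trans A
... | inj₁ (q , q∈ , (eq , lt) , min) =
  inj₁ (q , record { mem = q∈ ; line = eq ; after = lt ; nearest = λ s∈ e l → min s∈ (e , l) })
... | inj₂ none = inj₂ λ q∈ eq → ≮⇒≥ λ lt → none q∈ (eq , lt)

previous? : ∀ A d p → (∃ λ q → Before A d p q × (∀ {s} → Before A d p s → c (opp d) s ≤ c (opp d) q)) ⊎
                      (∀ {q} → ¬ Before A d p q)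
previous? A d p with least (λ q → (c d q ≟ c d p) ×-dec (c (opp d) q <? c (opp d) p))
                           {λ q s → c (opp d) s ≤ c (opp d) q} (λ _ _ → ≤-total _ _) (λ a b → ≤-trans b a) A
... | inj₁ (q , q∈ , (eq , lt) , max) = inj₁ (q , (q∈ , eq , lt) , λ (s∈ , e , l) → max s∈ (e , l))
... | inj₂ none = inj₂ λ (q∈ , eq , lt) → none q∈ (eq , lt)

initial? : ∀ A p → Dec (Initial A p)
initial? A p with previous? A up p | previous? A right p
... | inj₁ (_ , b , _) | _                = no λ i → i up b
... | inj₂ _           | inj₁ (_ , b , _) = no λ i → i right b
... | inj₂ ¬u          | inj₂ ¬r          = yes λ { up → ¬u ; right → ¬r }

Next⇒Before : ∀ {d} → p ∈ A → Next A d p q → Before A d q p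
Next⇒Before p∈ n = p∈ , sym line , after
  where open Next n

latest⇒Next : ∀ {d} → p ∈ A → Before A d p q → (∀ {s} → Before A d p s → c (opp d) s ≤ c (opp d) q) → Next A d q p
latest⇒Next p∈ (q∈ , eq , lt) max = record
  { mem = p∈ ; line = sym eq ; after = lt
  ; nearest = λ s∈ e l → ≮⇒≥ λ s<p → <⇒≱ l (max (s∈ , trans e eq , s<p)) }

Next-functional : ∀ d → Next A d p q → Next A d p s → q ≡ s
Next-functional d n m =
  point-ext d (trans n.line (sym m.line))
    (≤-antisym (n.nearest m.mem m.line m.after) (m.nearest n.mem n.line n.after))
  where
  module n = Next n
  module m = Next m

-- Along one line, two distinct predecessors would be ordered, and the earlier would have the later
-- as a nearer successor. Along two different lines, `s` would have a predecessor in each direction,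
-- which is the forbidden configuration.
Next-injective : Unambiguous A → ∀ d e → p ∈ A → q ∈ A → Next A d p s → Next A e q s → p ≡ q
Next-injective {p = p} {q} una d e p∈ q∈ n m with same-or-opp e d
... | inj₁ refl =
  point-ext d p-line
    (≤-antisym (≮⇒≥ λ q<p → <⇒≱ n.after (m.nearest p∈ p-line q<p))
               (≮⇒≥ λ p<q → <⇒≱ m.after (n.nearest q∈ (sym p-line) p<q)))
  where
  module n = Next n
  module m = Next m
  p-line : c d p ≡ c d q
  p-line = trans (sym n.line) m.line
... | inj₂ refl with una (Next.mem n)
...   | k , clear with same-or-opp k d
...     | inj₁ refl = ⊥-elim (clear (Next⇒Before p∈ n))
...     | inj₂ refl = ⊥-elim (clear (Next⇒Before q∈ m))

size : Point → ℕ
size p = x p + y p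

Next-size : ∀ d → Next A d p q → size p < size q
Next-size up    n = +-mono-≤-< (≤-reflexive (sym line)) after
  where open Next n
Next-size right n = +-mono-<-≤ after (≤-reflexive (sym line))
  where open Next n

-- Trees and forests read off a point set

-- While `Heap` looks only at the tree itself, here edges and leaves are compared with all of `A`:
-- no point of `A` is skipped along an edge or lies beyond a leaf on its lines.
data Follows (A : PointSet) : Tree → Set where
  leaf : p ∈ A → Terminal A p → Follows A (leaf p)
  node : root (node u r) ∈ A → (∀ d → Next A d (root (node u r)) (root (kid d u r))) →
         (∀ d → Follows A (kid d u r)) → Follows A (node u r)

Follows⇒Heap : Follows A t → Heap t
Follows⇒Heap (leaf _ _)      = leaf
Follows⇒Heap (node _ ns fs) =
  node (λ { up → Follows⇒Heap (fs up) ; right → Follows⇒Heap (fs right) })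
       (λ { up → Next.after (ns right) ; right → Next.after (ns up) })

Follows-∈ : Follows A t → p ∈ᵗ t → p ∈ A
Follows-∈ (leaf p∈ _)   (at-root refl)  = p∈
Follows-∈ (node p∈ _ _) (at-root refl)  = p∈
Follows-∈ (node _ _ fs) (in-kid d p∈)   = Follows-∈ (fs d) p∈

Follows-unique : Follows A t → Follows A t′ → root t ≡ root t′ → t ≡ t′
Follows-unique (leaf _ _)  (leaf _ _) eq = cong leaf eq
Follows-unique (leaf _ te) (node _ ns _) refl =
  ⊥-elim (<⇒≱ (Next.after (ns up)) (te up (Next.mem (ns up)) (Next.line (ns up))))
Follows-unique (node _ ns _) (leaf _ te) refl =
  ⊥-elim (<⇒≱ (Next.after (ns up)) (te up (Next.mem (ns up)) (Next.line (ns up))))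
Follows-unique {A} (node _ ns fs) (node _ ns′ fs′) eq =
  cong₂ node
    (Follows-unique (fs up) (fs′ up) (Next-functional up (ns up) (subst (λ p → Next A up p _) (sym eq) (ns′ up))))
    (Follows-unique (fs right) (fs′ right) (Next-functional right (ns right) (subst (λ p → Next A right p _) (sym eq) (ns′ right))))

Follows-leaf : ∀ d t → Follows A t → p ∈ word d t → Terminal A p
Follows-leaf d (leaf _) (leaf _ te) (here refl) = te
Follows-leaf d (node u r) (node _ _ fs) p∈ with word-kid⁻ d u r p∈
... | up    , p∈u = Follows-leaf up u (fs up) p∈u
... | right , p∈r = Follows-leaf right r (fs right) p∈r

Follows-branching : ∀ d → Follows A t → p ∈ᵗ t → p ∈ word d t ⊎ (∀ e → ∃ λ q → q ∈ᵗ t × Next A e p q)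
Follows-branching d (leaf _ _)    (at-root refl) = inj₁ (here refl)
Follows-branching d (node _ ns _) (at-root refl) = inj₂ λ e → _ , in-kid e root∈ , ns e
Follows-branching d (node _ _ fs) (in-kid k p∈) with Follows-branching k (fs k) p∈
... | inj₁ p∈w  = inj₁ (word-kid⁺ d k p∈w)
... | inj₂ next = inj₂ λ e → let q , q∈ , n = next e in q , in-kid k q∈ , n

Follows-closed : ∀ d → Follows A t → p ∈ᵗ t → Next A d p q → q ∈ᵗ t
Follows-closed {t = t} d f p∈ n with Follows-branching up f p∈
... | inj₁ p∈w = ⊥-elim (<⇒≱ (Next.after n) (Follows-leaf up t f p∈w d (Next.mem n) (Next.line n)))
... | inj₂ next with next d
...   | s , s∈ , n′ = subst (_∈ᵗ t) (Next-functional d n′ n) s∈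

HasParentIn : PointSet → Tree → Point → Set
HasParentIn A t p = ∃ λ d → ∃ λ q → q ∈ᵗ t × q ∈ A × Next A d q p

Follows-parent : Follows A t → p ∈ᵗ t → p ≡ root t ⊎ HasParentIn A t p
Follows-parent _ (at-root eq) = inj₁ eq
Follows-parent f@(node r∈ ns fs) (in-kid d p∈) with Follows-parent (fs d) p∈
... | inj₁ refl                    = inj₂ (d , _ , root∈ , r∈ , ns d)
... | inj₂ (e , q , q∈ , q∈A , n) = inj₂ (e , q , in-kid d q∈ , q∈A , n)

-- Going from a common point to its parent stays in both trees until a root is met.
Follows-meet : Unambiguous A → Follows A t → Follows A t′ → ∀ k p → size p ≤ k →
               p ∈ᵗ t → p ∈ᵗ t′ → root t ∈ᵗ t′ ⊎ root t′ ∈ᵗ t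
Follows-meet una f f′ k p le p∈ p∈′ with Follows-parent f p∈ | Follows-parent f′ p∈′
... | inj₁ refl | _         = inj₁ p∈′
... | inj₂ _    | inj₁ refl = inj₂ p∈
Follows-meet una f f′ zero p le p∈ p∈′ | inj₂ (d , q , _ , _ , n) | inj₂ _ =
  ⊥-elim (n≮0 (<-≤-trans (Next-size d n) le))
Follows-meet {t′ = t′} una f f′ (suc k) p le p∈ p∈′
  | inj₂ (d , q , q∈ , q∈A , n) | inj₂ (d′ , q′ , q′∈ , q′∈A , n′) =
  Follows-meet una f f′ k q (≤-pred (<-≤-trans (Next-size d n) le)) q∈
    (subst (_∈ᵗ t′) (Next-injective una d′ d q′∈A q∈A n′ n) q′∈)

Terminal-unique : ∀ d → p ∈ A → q ∈ A → Terminal A p → Terminal A q → c d p ≡ c d q → p ≡ q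
Terminal-unique d p∈ q∈ tp tq eq = point-ext d eq (≤-antisym (tq d p∈ eq) (tp d q∈ (sym eq)))

-- Points on a common line lead to leaves on that line, and these coincide because a line has at
-- most one terminal point. The trees thus meet, and by `Follows-meet` one contains the root of the
-- other.
Follows-apart : Unambiguous A → Follows A t → Follows A t′ →
                ¬ root t ∈ᵗ t′ → ¬ root t′ ∈ᵗ t → Apart t t′
Follows-apart {t = t} {t′} una f f′ t∉ t′∉ d p∈ q∈ eq with leaf-on-line d up p∈ | leaf-on-line d up q∈
... | l , l∈ , lp | m , m∈ , mq =
  [ t∉ , t′∉ ]′ (Follows-meet una f f′ _ l ≤-refl l∈t (subst (_∈ᵗ t′) (sym l≡m) m∈t′))
  where
  l∈t : l ∈ᵗ t
  l∈t = word⊆ up t l∈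
  m∈t′ : m ∈ᵗ t′
  m∈t′ = word⊆ up t′ m∈
  l≡m : l ≡ m
  l≡m = Terminal-unique d (Follows-∈ f l∈t) (Follows-∈ f′ m∈t′)
          (Follows-leaf up t f l∈) (Follows-leaf up t′ f′ m∈) (trans lp (trans eq (sym mq)))

Follows⇒Separated : Unambiguous A → Follows A t → Separated t
Follows⇒Separated una (leaf _ _) = leaf
Follows⇒Separated {A} una f@(node {u = u} {r} r∈ ns fs) with Follows⇒Heap f
... | node hs lt =
  node (λ { up → Follows⇒Separated una (fs up) ; right → Follows⇒Separated una (fs right) })
       (Follows-apart una (fs up) (fs right) (not-in up) (not-in right))
  where
  not-in : ∀ d → ¬ root (kid d u r) ∈ᵗ kid (opp d) u r
  not-in d k∈ with Follows-parent (fs (opp d)) k∈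
  ... | inj₁ eq = <-irrefl (cong (c d) eq) (lt d)
  -- The parent of the kid's root would lie in the other kid too. It is the root of the node, whose
  -- `c d` is smaller than that of every point there.
  ... | inj₂ (e , q , q∈ , q∈A , n) =
    <⇒≱ (lt d) (subst (c d (root (kid (opp d) u r)) ≤_) (trans (cong (c d) q≡) (root-kid d u r))
      (root-min (hs (opp d)) q∈ d))
    where
    q≡ : q ≡ root (node u r)
    q≡ = Next-injective una e d q∈A r∈ n (ns d)

record Represents (A : PointSet) (F : List Tree) : Set where
  field
    follows : ∀ {t} → t ∈ F → Follows A t
    initial : ∀ {t} → t ∈ F → Initial A (root t)
    ordered : AllPairs (λ t t′ → x (root t) < x (root t′)) F
    covers  : ∀ {p} → p ∈ A → Initial A p → ∃ λ t → t ∈ F × root t ≡ p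

-- The roots on both sides are exactly the initial points of `A`, and a tree following `A` is
-- determined by its root.
Represents-unique : Represents A F → Represents A F′ → F ≡ F′
Represents-unique R R′ = AllPairs-unique <-asym (Represents.ordered R) (Represents.ordered R′) (sub R R′) (sub R′ R)
  where
  sub : ∀ {A F F′} → Represents A F → Represents A F′ → t ∈ F → t ∈ F′
  sub R R′ t∈ with Represents.covers R′ (Follows-∈ (Represents.follows R t∈) root∈) (Represents.initial R t∈)
  ... | t′ , t′∈ , eq =
    subst (_∈ _) (Follows-unique (Represents.follows R′ t′∈) (Represents.follows R t∈) eq) t′∈

Represents⇒Valid : Unambiguous A → Represents A F → Valid F
Represents⇒Valid una R = record
  { heaps     = Follows⇒Heap ∘ follows
  ; separated = Follows⇒Separated una ∘ follows
  ; ordered   = ordered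
  ; apart     = AllPairs-map∈ (λ t∈ t′∈ lt → Follows-apart una (follows t∈) (follows t′∈)
                  (not-in t∈ t′∈ (<⇒≢ lt)) (not-in t′∈ t∈ (<⇒≢ lt ∘ sym))) ordered
  }
  where
  open Represents R
  not-in : t ∈ _ → t′ ∈ _ → x (root t) ≢ x (root t′) → ¬ root t ∈ᵗ t′
  not-in t∈ t′∈ ne r∈ with Follows-parent (follows t′∈) r∈
  ... | inj₁ eq = ne (cong x eq)
  ... | inj₂ (d , q , _ , q∈A , n) = initial t∈ d (Next⇒Before q∈A n)

parent? : p ∈ A → Initial A p ⊎ (∃ λ d → ∃ λ q → q ∈ A × Next A d q p)
parent? {p} {A} p∈ with previous? A up p | previous? A right p
... | inj₂ ¬u          | inj₂ ¬r            = inj₁ λ { up → ¬u ; right → ¬r }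
... | inj₁ (q , b , max) | _                  = inj₂ (up , q , proj₁ b , latest⇒Next p∈ b max)
... | inj₂ _           | inj₁ (q , b , max) = inj₂ (right , q , proj₁ b , latest⇒Next p∈ b max)

-- Parents have smaller `size`, so the walk through parents reaches an initial point, which is the
-- root of a listed tree; `Follows-closed` then carries membership back along the walk.
Represents-covers : Represents A F → ∀ k → size p ≤ k → p ∈ A → ∃ λ t → t ∈ F × p ∈ᵗ t
Represents-covers R k le p∈ with parent? p∈
... | inj₁ i with Represents.covers R p∈ i
...   | t , t∈ , refl = t , t∈ , root∈
Represents-covers R zero le p∈ | inj₂ (d , q , q∈ , n) = ⊥-elim (n≮0 (<-≤-trans (Next-size d n) le))
Represents-covers R (suc k) le p∈ | inj₂ (d , q , q∈ , n)
  with Represents-covers R k (≤-pred (<-≤-trans (Next-size d n) le)) q∈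
... | t , t∈ , q∈t = t , t∈ , Follows-closed d (Represents.follows R t∈) q∈t n

_∈ᶠ_ : Point → List Tree → Set
p ∈ᶠ F = ∃ λ t → t ∈ F × p ∈ᵗ t

Represents-leaves : Represents A F → p ∈ A → Terminal A p ⇔ p ∈ forestWord F
Represents-leaves {A} {F} {p} R p∈ = mk⇔ to from
  where
  to : Terminal A p → p ∈ forestWord F
  to te with Represents-covers R _ ≤-refl p∈
  ... | t , t∈ , p∈t with Follows-branching up (Represents.follows R t∈) p∈t
  ...   | inj₁ p∈w = forestWord⁺ t∈ p∈w
  ...   | inj₂ next with next up
  ...     | q , _ , n = ⊥-elim (<⇒≱ (Next.after n) (te up (Next.mem n) (Next.line n)))
  from : p ∈ forestWord F → Terminal A p
  from p∈w with forestWord⁻ F p∈w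
  ... | t , t∈ , p∈t = Follows-leaf up t (Represents.follows R t∈) p∈t

Represents⇒Branching : Represents A F → Branching A
Represents⇒Branching R p∈ with Represents-covers R _ ≤-refl p∈
... | t , t∈ , p∈t with Follows-branching up (Represents.follows R t∈) p∈t
...   | inj₁ p∈w  = inj₁ (Equivalence.from (Represents-leaves R p∈) (forestWord⁺ t∈ p∈w))
...   | inj₂ next = inj₂ λ d → let q , _ , n = next d in q , n

Represents-∈ : Represents A F → p ∈ᶠ F → p ∈ A
Represents-∈ R (t , t∈ , p∈) = Follows-∈ (Represents.follows R t∈) p∈

-- The forest of a point set

weight : PointSet → ℕ
weight A = sum (map size A)

size≤weight : ∀ A → p ∈ A → size p ≤ weight A
size≤weight (_ ∷ A) (here refl) = m≤m+n _ _
size≤weight (q ∷ A) (there p∈)  = ≤-trans (size≤weight A p∈) (m≤n+m _ (size q))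

-- The first argument is fuel; weight A is enough because the size of points grows along edges.
treeAt : ℕ → PointSet → Point → Tree
treeAt zero    A p = leaf p
treeAt (suc k) A p with next? A up p | next? A right p
... | inj₁ (q , _) | inj₁ (s , _) = node (treeAt k A q) (treeAt k A s)
-- A default value: when `A` is `Branching`, a point cannot have a successor in just one direction.
... | inj₁ _       | inj₂ _       = leaf p
... | inj₂ _       | _            = leaf p

forestOf : PointSet → List Tree
forestOf A = map (treeAt (weight A) A) (filter (initial? A) A)

treeAt-follows : Branching A → ∀ k → p ∈ A → weight A ≤ k + size p →
                 Follows A (treeAt k A p) × root (treeAt k A p) ≡ p
treeAt-follows {A} {p} br zero p∈ le = leaf p∈ terminal , refl
  where
  terminal : Terminal A p
  terminal with br p∈
  ... | inj₁ te = te
  ... | inj₂ next with next up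
  -- With the fuel exhausted, the invariant reads `weight A ≤ size p`, so a successor would be
  -- larger than any point of `A` can be.
  ...   | q , n = ⊥-elim (<⇒≱ (Next-size up n) (≤-trans (size≤weight A (Next.mem n)) le))
treeAt-follows {A} {p} br (suc k) p∈ le with next? A up p | next? A right p
... | inj₁ (q , n) | inj₁ (s , m)
  with treeAt k A q | treeAt-follows br k (Next.mem n) (step up n)
     | treeAt k A s | treeAt-follows br k (Next.mem m) (step right m)
  where
  step : ∀ d {q} → Next A d p q → weight A ≤ k + size q
  step d n = ≤-trans le (≤-trans (≤-reflexive (sym (+-suc k (size p)))) (+-monoʳ-≤ k (Next-size d n)))
... | u | fu , refl | r | fr , refl =
  node (subst (_∈ A) (sym root≡) p∈)
       (λ { up    → subst (λ v → Next A up v (root u)) (sym root≡) n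
          ; right → subst (λ v → Next A right v (root r)) (sym root≡) m })
       (λ { up → fu ; right → fr }) , root≡
  where
  root≡ : (x (root u) , y (root r)) ≡ p
  root≡ = cong₂ _,_ (Next.line n) (Next.line m)
treeAt-follows {A} {p} br (suc k) p∈ le | inj₁ (q , n) | inj₂ la with br p∈
... | inj₁ te = leaf p∈ te , refl
... | inj₂ next with next right
...   | s , m = ⊥-elim (<⇒≱ (Next.after m) (la (Next.mem m) (Next.line m)))
treeAt-follows {A} {p} br (suc k) p∈ le | inj₂ la | _ with br p∈
... | inj₁ te = leaf p∈ te , refl
... | inj₂ next with next up
...   | s , m = ⊥-elim (<⇒≱ (Next.after m) (la (Next.mem m) (Next.line m)))

-- Canonical lists of points

<ₚ-trans : p <ₚ q → q <ₚ s → p <ₚ s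
<ₚ-trans (inj₁ l)       (inj₁ l′)        = inj₁ (<-trans l l′)
<ₚ-trans (inj₁ l)       (inj₂ (e , _))   = inj₁ (<-≤-trans l (≤-reflexive e))
<ₚ-trans (inj₂ (e , _)) (inj₁ l)         = inj₁ (≤-<-trans (≤-reflexive e) l)
<ₚ-trans (inj₂ (e , l)) (inj₂ (e′ , l′)) = inj₂ (trans e e′ , <-trans l l′)

<ₚ-asym : p <ₚ q → q <ₚ p → ⊥
<ₚ-asym {p} p<q q<p with <ₚ-trans {p} p<q q<p
... | inj₁ l       = <-irrefl refl l
... | inj₂ (_ , l) = <-irrefl refl l

canonical⇒AllPairs : IsCanonical A → AllPairs _<ₚ_ A
canonical⇒AllPairs = Linked⇒AllPairs (λ {p} {q} {s} → <ₚ-trans {p} {q} {s})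

canonical-unique : IsCanonical A → IsCanonical A′ →
                   (∀ {p} → p ∈ A → p ∈ A′) → (∀ {p} → p ∈ A′ → p ∈ A) → A ≡ A′
canonical-unique ca ca′ =
  AllPairs-unique (λ {p} {q} → <ₚ-asym {p} {q}) (canonical⇒AllPairs ca) (canonical⇒AllPairs ca′)

<ₚ-cmp : ∀ p q → p <ₚ q ⊎ p ≡ q ⊎ q <ₚ p
<ₚ-cmp p q with <-cmp (x p) (x q) | <-cmp (y p) (y q)
... | tri< l _ _ | _          = inj₁ (inj₁ l)
... | tri> _ _ l | _          = inj₂ (inj₂ (inj₁ l))
... | tri≈ _ e _ | tri< l _ _ = inj₁ (inj₂ (e , l))
... | tri≈ _ e _ | tri≈ _ f _ = inj₂ (inj₁ (cong₂ _,_ e f))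
... | tri≈ _ e _ | tri> _ _ l = inj₂ (inj₂ (inj₂ (sym e , l)))

insertion : ∀ p A → AllPairs _<ₚ_ A → ∃ λ B → AllPairs _<ₚ_ B × (∀ {q} → q ∈ B ⇔ q ∈ p ∷ A)
insertion p []      _         = p ∷ [] , [] ∷ [] , ⇔-id _
insertion p (a ∷ A) (a< ∷ As) with <ₚ-cmp p a
... | inj₁ p<a         = p ∷ a ∷ A , (p<a ∷ All.map (λ {q} → <ₚ-trans {p} {a} {q} p<a) a<) ∷ a< ∷ As , ⇔-id _
... | inj₂ (inj₁ refl) = a ∷ A , a< ∷ As , mk⇔ there λ { (here eq) → here eq ; (there q∈) → q∈ }
... | inj₂ (inj₂ a<p) with insertion p A As
...   | B , Bs , B≈ = a ∷ B , All.tabulate (All.lookup (a<p ∷ a<) ∘ Equivalence.to B≈) ∷ Bs ,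
  mk⇔ (λ { (here eq) → there (here eq) ; (there q∈) → swap (Equivalence.to B≈ q∈) })
      (λ { (here eq) → there (Equivalence.from B≈ (here eq)) ; (there (here eq)) → here eq
         ; (there (there q∈)) → there (Equivalence.from B≈ (there q∈)) })
  where
  swap : q ∈ p ∷ A → q ∈ p ∷ a ∷ A
  swap (here eq)  = here eq
  swap (there q∈) = there (there q∈)

canonicalise : ∀ L → ∃ λ A → IsCanonical A × (∀ {p} → p ∈ A ⇔ p ∈ L)
canonicalise L = let A , As , A≈ = sorted L in A , AllPairs⇒Linked As , A≈
  where
  sorted : ∀ L → ∃ λ A → AllPairs _<ₚ_ A × (∀ {p} → p ∈ A ⇔ p ∈ L)
  sorted []      = [] , [] , ⇔-id _
  sorted (p ∷ L) with sorted L
  ... | A , As , A≈ with insertion p A As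
  ...   | B , Bs , B≈ = B , Bs , λ {q} → mk⇔
    (λ q∈ → ∈-cons⁺ (Equivalence.to A≈) (Equivalence.to B≈ q∈))
    (λ q∈ → Equivalence.from B≈ (∈-cons⁺ (Equivalence.from A≈) q∈))
    where
    ∈-cons⁺ : ∀ {L M} → (q ∈ L → q ∈ M) → q ∈ p ∷ L → q ∈ p ∷ M
    ∈-cons⁺ f (here eq)  = here eq
    ∈-cons⁺ f (there q∈) = there (f q∈)

Represents-forestOf : IsCanonical A → Branching A → Represents A (forestOf A)
Represents-forestOf {A} ca br = record
  { follows = λ t∈ → let p , p∈ , _ , eq = from t∈ in subst (Follows A) (sym eq) (proj₁ (tree p∈))
  ; initial = λ t∈ → let p , p∈ , i , eq = from t∈ in
                subst (Initial A) (sym (trans (cong root eq) (proj₂ (tree p∈)))) i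
  ; ordered = AllPairs.map⁺ (AllPairs-map∈ increasing (AllPairs.filter⁺ (initial? A) (canonical⇒AllPairs ca)))
  ; covers  = λ p∈ i → _ , ∈-map⁺ _ (∈-filter⁺ (initial? A) p∈ i) , proj₂ (tree p∈)
  }
  where
  tree : p ∈ A → Follows A (treeAt (weight A) A p) × root (treeAt (weight A) A p) ≡ p
  tree p∈ = treeAt-follows br (weight A) p∈ (m≤m+n _ _)
  unfilter : p ∈ filter (initial? A) A → p ∈ A × Initial A p
  unfilter = ∈-filter⁻ (initial? A) {xs = A}
  from : t ∈ forestOf A → ∃ λ p → p ∈ A × Initial A p × t ≡ treeAt (weight A) A p
  from t∈ with ∈-map⁻ _ t∈
  ... | p , p∈ , eq with unfilter p∈
  ...   | p∈A , i = p , p∈A , i , eq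
  increasing : ∀ {p q} → p ∈ filter (initial? A) A → q ∈ filter (initial? A) A → p <ₚ q →
               x (root (treeAt (weight A) A p)) < x (root (treeAt (weight A) A q))
  increasing p∈ q∈ (inj₁ l) =
    subst₂ _<_ (cong x (sym (proj₂ (tree (proj₁ (unfilter p∈))))))
               (cong x (sym (proj₂ (tree (proj₁ (unfilter q∈)))))) l
  -- Two initial points never share a column, since the lower one would precede the upper; the
  -- lexicographic order of `A` therefore orders roots strictly by column.
  increasing p∈ q∈ (inj₂ (e , l)) = ⊥-elim (proj₂ (unfilter q∈) up (proj₁ (unfilter p∈) , e , l))

-- The point set of a forest

points : Tree → List Point
points (leaf p)     = p ∷ []
points t@(node u r) = root t ∷ points u ++ points r

∈-points⁺ : p ∈ᵗ t → p ∈ points t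
∈-points⁺ {t = leaf _}   (at-root refl) = here refl
∈-points⁺ {t = node _ _} (at-root refl) = here refl
∈-points⁺ (in-kid up p∈)            = there (∈-++⁺ˡ (∈-points⁺ p∈))
∈-points⁺ (in-kid {u = u} right p∈) = there (∈-++⁺ʳ (points u) (∈-points⁺ p∈))

∈-points⁻ : ∀ t → p ∈ points t → p ∈ᵗ t
∈-points⁻ (leaf _)   (here refl) = root∈
∈-points⁻ (node _ _) (here refl) = root∈
∈-points⁻ (node u r) (there p∈)  =
  [ in-kid up ∘ ∈-points⁻ u , in-kid right ∘ ∈-points⁻ r ]′ (∈-++⁻ (points u) p∈)

-- For a whole tree of the forest the first alternative suffices. The second makes the property pass
-- to subtrees, since the line joining a kid to its parent also carries points before the kid.
Owns : PointSet → Tree → Set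
Owns A t = ∀ d {p q} → p ∈ᵗ t → q ∈ A → c d q ≡ c d p →
           q ∈ᵗ t ⊎ Before A d (root t) q

module _ {A u r} (h : Heap (node u r)) (ap : Apart u r) (own : Owns A (node u r)) where

  -- Only the line along the edge `e` leads back out of the kid. On a line of the other kind, a
  -- point outside the kid would put that line in common with the sibling, contradicting `Apart`.
  kid-line : ∀ e d → p ∈ᵗ kid e u r → q ∈ A → c d q ≡ c d p →
             q ∈ᵗ kid e u r ⊎ (d ≡ e × Before A d (root (kid e u r)) q)
  kid-line e d p∈ q∈ eq with own d (in-kid e p∈) q∈ eq | same-or-opp d e
  ... | inj₁ (at-root refl) | inj₁ refl = inj₂ (refl , q∈ , root-kid e u r , root<kid e h)
  ... | inj₁ (at-root refl) | inj₂ refl =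
    ⊥-elim (kids-apart ap e d p∈ root∈ (trans (sym eq) (root-kid d u r)))
  ... | inj₂ (_ , l , b) | inj₁ refl =
    inj₂ (refl , q∈ , trans l (root-kid e u r) , <-trans b (root<kid e h))
  ... | inj₂ (_ , l , _) | inj₂ refl =
    ⊥-elim (kids-apart ap e d p∈ root∈ (trans (sym eq) (trans l (root-kid d u r))))
  ... | inj₁ (in-kid k q∈k) | _ with same-or-opp k e
  ...   | inj₁ refl = inj₁ q∈k
  ...   | inj₂ refl = ⊥-elim (kids-apart ap e d p∈ q∈k (sym eq))

  Owns-kid : ∀ e → Owns A (kid e u r)
  Owns-kid e d p∈ q∈ eq with kid-line e d p∈ q∈ eq
  ... | inj₁ q∈k     = inj₁ q∈k
  ... | inj₂ (_ , b) = inj₂ b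

  kid-clear : ∀ e → Heap (kid e u r) → ¬ Before A (opp e) (root (kid e u r)) q
  kid-clear up    hk (q∈ , l , b) with kid-line up right root∈ q∈ l
  -- The other alternative of `kid-line` needs `right ≡ up`, so coverage checking dismisses it; this
  -- is why the proof splits on `e`.
  ... | inj₁ q∈k = <⇒≱ b (root-min hk q∈k up)
  kid-clear right hk (q∈ , l , b) with kid-line right up root∈ q∈ l
  ... | inj₁ q∈k = <⇒≱ b (root-min hk q∈k right)

Owns⇒Follows : Heap t → Separated t → Owns A t → (∀ {p} → p ∈ᵗ t → p ∈ A) → Follows A t
Owns⇒Follows {A = A} (leaf {p}) leaf own sub = leaf (sub root∈) terminal
  where
  terminal : Terminal A p
  terminal d q∈ eq with own d root∈ q∈ eq
  ... | inj₁ (at-root refl) = ≤-refl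
  ... | inj₂ (_ , _ , b)    = <⇒≤ b
Owns⇒Follows {A = A} h@(node {u = u} {r} hs lt) (node ss ap) own sub =
  node (sub root∈) next λ
    { up    → Owns⇒Follows (hs up) (ss up) (Owns-kid h ap own up) (sub ∘ in-kid up)
    ; right → Owns⇒Follows (hs right) (ss right) (Owns-kid h ap own right) (sub ∘ in-kid right) }
  where
  next : ∀ d → Next A d (root (node u r)) (root (kid d u r))
  next d = record
    { mem = sub (in-kid d root∈) ; line = sym (root-kid d u r) ; after = root<kid d h ; nearest = nearest }
    where
    nearest : s ∈ A → c d s ≡ c d (root (node u r)) → c (opp d) (root (node u r)) < c (opp d) s →
              c (opp d) (root (kid d u r)) ≤ c (opp d) s
    nearest s∈ eq l with own d root∈ s∈ eq
    ... | inj₁ (at-root refl) = ⊥-elim (<-irrefl refl l)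
    ... | inj₂ (_ , _ , b)    = ⊥-elim (<-asym l b)
    ... | inj₁ (in-kid k s∈k) with same-or-opp k d
    ...   | inj₁ refl = root-min (hs d) s∈k (opp d)
    ...   | inj₂ refl = ⊥-elim (kids-apart ap d d root∈ s∈k (trans (sym (root-kid d u r)) (sym eq)))

-- A point reached by an edge in direction `e` has no predecessor in direction `opp e`. Only the
-- root needs a clear direction as an assumption.
Owns⇒clear : Heap t → Separated t → Owns A t → (∃ λ d → ∀ {q} → ¬ Before A d (root t) q) →
             p ∈ᵗ t → ∃ λ d → ∀ {q} → ¬ Before A d p q
Owns⇒clear _ _ _ clear (at-root refl) = clear
Owns⇒clear h@(node hs _) (node ss ap) own _ (in-kid e p∈) =
  Owns⇒clear (hs e) (ss e) (Owns-kid h ap own e) (opp e , kid-clear h ap own e (hs e)) p∈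

module _ {A F} (v : Valid F) (A≈F : ∀ {p} → p ∈ A ⇔ p ∈ᶠ F) where

  open Valid v

  tree-line : ∀ d → t ∈ F → p ∈ᵗ t → q ∈ A → c d q ≡ c d p → q ∈ᵗ t
  tree-line d t∈ p∈ q∈ eq with Equivalence.to A≈F q∈
  ... | t′ , t′∈ , q∈t′ with AllPairs-lookup apart t∈ t′∈
  ...   | inj₁ refl      = q∈t′
  ...   | inj₂ (inj₁ ap) = ⊥-elim (ap d p∈ q∈t′ (sym eq))
  ...   | inj₂ (inj₂ ap) = ⊥-elim (ap d q∈t′ p∈ eq)

  tree-owns : t ∈ F → Owns A t
  tree-owns t∈ d p∈ q∈ eq = inj₁ (tree-line d t∈ p∈ q∈ eq)

  root-initial : t ∈ F → Initial A (root t)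
  root-initial t∈ up    (q∈ , l , b) = <⇒≱ b (root-min (heaps t∈) (tree-line up t∈ root∈ q∈ l) right)
  root-initial t∈ right (q∈ , l , b) = <⇒≱ b (root-min (heaps t∈) (tree-line right t∈ root∈ q∈ l) up)

  Valid⇒Unambiguous : Unambiguous A
  Valid⇒Unambiguous p∈ with Equivalence.to A≈F p∈
  ... | t , t∈ , p∈t = Owns⇒clear (heaps t∈) (separated t∈) (tree-owns t∈) (up , root-initial t∈ up) p∈t

  Valid⇒Represents : Represents A F
  Valid⇒Represents = record { follows = follows ; initial = root-initial ; ordered = ordered ; covers = covers }
    where
    follows : t ∈ F → Follows A t
    follows t∈ = Owns⇒Follows (heaps t∈) (separated t∈) (tree-owns t∈) (λ p∈ → Equivalence.from A≈F (_ , t∈ , p∈))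
    covers : ∀ {p} → p ∈ A → Initial A p → ∃ λ t → t ∈ F × root t ≡ p
    covers p∈ i with Equivalence.to A≈F p∈
    ... | t , t∈ , p∈t with Follows-parent (follows t∈) p∈t
    ...   | inj₁ eq = t , t∈ , sym eq
    ...   | inj₂ (d , q , _ , q∈A , n) = ⊥-elim (i d (Next⇒Before q∈A n))

-- Complete non-ambiguous forests

NoAmbiguity⇒Unambiguous : NoAmbiguity A → Unambiguous A
NoAmbiguity⇒Unambiguous {A} na {p} p∈ with previous? A up p
... | inj₂ clear = up , clear
... | inj₁ (q , (q∈ , ql , q<) , _) =
  right , λ {s} (s∈ , sl , s<) → na (p , q , s , p∈ , q∈ , s∈ , ql , q< , sl , s<)

Unambiguous⇒NoAmbiguity : Unambiguous A → NoAmbiguity A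
Unambiguous⇒NoAmbiguity una (p , q , s , p∈ , q∈ , s∈ , ql , q< , sl , s<) with una p∈
... | up    , clear = clear (q∈ , ql , q<)
... | right , clear = clear (s∈ , sl , s<)

Parent⇒Next : Parent A q p → ∃ λ d → Next A d q p
Parent⇒Next (p∈ , inj₁ (b , max))     = up , latest⇒Next p∈ b (max _)
Parent⇒Next (p∈ , inj₂ (_ , b , max)) = right , latest⇒Next p∈ b (max _)

Next⇒latest : ∀ d → Next A d q p → Before A d p s → c (opp d) s ≤ c (opp d) q
Next⇒latest d n (s∈ , sl , s<) = ≮⇒≥ λ q<s → <⇒≱ s< (nearest s∈ (trans sl line) q<s)
  where open Next n

-- `Parent` gives priority to the point below, so a right edge counts only if nothing lies below its
-- end. Unambiguity guarantees this, as the end has a point to its left.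
Next⇒Parent : Unambiguous A → ∀ d → q ∈ A → Next A d q p → Parent A q p
Next⇒Parent una up q∈ n = Next.mem n , inj₁ (Next⇒Before q∈ n , λ _ → Next⇒latest up n)
Next⇒Parent una right q∈ n with una (Next.mem n)
... | up    , clear = Next.mem n , inj₂ ((λ (_ , b) → clear b) , Next⇒Before q∈ n , λ _ → Next⇒latest right n)
... | right , clear = ⊥-elim (clear (Next⇒Before q∈ n))

IsLeaf⇒Terminal : Unambiguous A → p ∈ A → IsLeaf A p → Terminal A p
IsLeaf⇒Terminal {A} {p} una p∈ lf d with next? A d p
... | inj₁ (q , n) = ⊥-elim (lf q (Next⇒Parent una d p∈ n))
... | inj₂ last    = last

Terminal⇒IsLeaf : Terminal A p → IsLeaf A p
Terminal⇒IsLeaf te q par with Parent⇒Next par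
... | d , n = <⇒≱ (Next.after n) (te d (Next.mem n) (Next.line n))

-- Each direction offers at most one child, so two distinct children occupy one direction each.
IsComplete⇒Branching : Unambiguous A → IsComplete A → Branching A
IsComplete⇒Branching una co {p} p∈ with co p p∈
... | inj₁ lf = inj₁ (IsLeaf⇒Terminal una p∈ lf)
... | inj₂ (c₁ , c₂ , c₁≢c₂ , par₁ , par₂ , _) with Parent⇒Next par₁ | Parent⇒Next par₂
...   | up    , n | right , m = inj₂ λ { up → _ , n ; right → _ , m }
...   | right , n | up    , m = inj₂ λ { up → _ , m ; right → _ , n }
...   | up    , n | up    , m = ⊥-elim (c₁≢c₂ (Next-functional up n m))
...   | right , n | right , m = ⊥-elim (c₁≢c₂ (Next-functional right n m))

Branching⇒IsComplete : Unambiguous A → Branching A → IsComplete A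
Branching⇒IsComplete {A} una br p p∈ with br p∈
... | inj₁ te = inj₁ (Terminal⇒IsLeaf te)
... | inj₂ next with next up | next right
...   | q , n | s , m =
  inj₂ (q , s , q≢s , Next⇒Parent una up p∈ n , Next⇒Parent una right p∈ m , λ _ → only ∘ Parent⇒Next)
  where
  q≢s : q ≢ s
  q≢s refl = <-irrefl (sym (Next.line m)) (Next.after n)
  only : ∀ {v} → (∃ λ d → Next A d p v) → v ≡ q ⊎ v ≡ s
  only (up    , n′) = inj₁ (Next-functional up n′ n)
  only (right , m′) = inj₂ (Next-functional right m′ m)

Differ⇒Unique : ∀ {w} → AllPairs Differ w → Unique w
Differ⇒Unique = AllPairs.map (λ df eq → df up (cong x eq))

-- From complete non-ambiguous forests to permutations

module _ {n} (cnaf : IsCNAF n A) where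

  private
    naf : IsNAF A
    naf = proj₁ cnaf

  IsCNAF-unambiguous : Unambiguous A
  IsCNAF-unambiguous = NoAmbiguity⇒Unambiguous (proj₂ (proj₂ (proj₂ (proj₂ naf))))

  IsCNAF-represents : Represents A (forestOf A)
  IsCNAF-represents =
    Represents-forestOf (proj₁ naf) (IsComplete⇒Branching IsCNAF-unambiguous (proj₁ (proj₂ cnaf)))

  IsCNAF-valid : Valid (forestOf A)
  IsCNAF-valid = Represents⇒Valid IsCNAF-unambiguous IsCNAF-represents

  private
    w : List Point
    w = forestWord (forestOf A)

    w-distinct : AllPairs Differ w
    w-distinct = forestWord-distinct (forestOf A) IsCNAF-valid

    w⊆A : p ∈ w → p ∈ A
    w⊆A p∈ with forestWord⁻ (forestOf A) p∈
    ... | t , t∈ , p∈t = Represents-∈ IsCNAF-represents (t , t∈ , word⊆ up t p∈t)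

    w-length : length w ≡ n
    w-length with proj₂ (proj₂ cnaf)
    ... | L , uL , L≈ , len = trans (↭-length (Unique-set⇒↭ (Differ⇒Unique w-distinct) uL sub sup)) len
      where
      sub : p ∈ w → p ∈ L
      sub p∈ = Equivalence.from (L≈ _)
        (w⊆A p∈ , Terminal⇒IsLeaf (Equivalence.from (Represents-leaves IsCNAF-represents (w⊆A p∈)) p∈))
      sup : p ∈ L → p ∈ w
      sup p∈ with Equivalence.to (L≈ _) p∈
      ... | p∈A , lf =
        Equivalence.to (Represents-leaves IsCNAF-represents p∈A) (IsLeaf⇒Terminal IsCNAF-unambiguous p∈A lf)

    positive : ∀ d → p ∈ A → 1 ≤ c d p
    positive up    p∈ = proj₁ (proj₁ (proj₂ naf) _ p∈)
    positive right p∈ = proj₂ (proj₁ (proj₂ naf) _ p∈)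

    gapless : ∀ d → p ∈ A → ∀ i → 1 ≤ i → i < c d p → ∃ λ q → q ∈ A × c d q ≡ i
    gapless up    = proj₁ (proj₂ (proj₂ naf)) _
    gapless right = proj₁ (proj₂ (proj₂ (proj₂ naf))) _

  IsCNAF-perm : ∀ d → IsPerm n (map (c d) w)
  IsCNAF-perm d = subst (λ k → IsPerm k (map (c d) w)) (trans (length-map (c d) w) w-length)
    (gapless⇒↭ (AllPairs.map⁺ (AllPairs.map (λ df → df d) w-distinct)) pos closed)
    where
    pos : ∀ {v} → v ∈ map (c d) w → 1 ≤ v
    pos v∈ with ∈-map⁻ (c d) v∈
    ... | p , p∈ , refl = positive d (w⊆A p∈)
    closed : ∀ {v} → v ∈ map (c d) w → ∀ {i} → 1 ≤ i → i < v → i ∈ map (c d) w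
    closed v∈ {i} 1≤i i<v with ∈-map⁻ (c d) v∈
    ... | p , p∈ , refl with gapless d (w⊆A p∈) i 1≤i i<v
    ...   | q , q∈ , refl with Represents-covers IsCNAF-represents _ ≤-refl q∈
    -- The point on line `i` supplied by gaplessness need not be a leaf, but its tree has a leaf on
    -- that line.
    ...     | t , t∈ , q∈t with leaf-on-line d up q∈t
    ...       | l , l∈ , eq = subst (_∈ map (c d) w) eq (∈-map⁺ (c d) (forestWord⁺ t∈ l∈))

-- From valid forests to complete non-ambiguous forests

module _ {n} (v : Valid F) (perm : ∀ d → IsPerm n (map (c d) (forestWord F)))
         (A≈F : ∀ {p} → p ∈ A ⇔ p ∈ᶠ F) where

  private
    una : Unambiguous A
    una = Valid⇒Unambiguous v A≈F

    rep : Represents A F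
    rep = Valid⇒Represents v A≈F

    w⊆A : p ∈ forestWord F → p ∈ A
    w⊆A p∈ with forestWord⁻ F p∈
    ... | t , t∈ , p∈t = Represents-∈ rep (t , t∈ , word⊆ up t p∈t)

    coordinate : ∀ d → p ∈ A → ∃ λ i → i < n × c d p ≡ suc i
    coordinate d p∈ with Equivalence.to A≈F p∈
    ... | t , t∈ , p∈t with leaf-on-line d up p∈t
    ...   | l , l∈ , eq =
      ∈-applyUpTo⁻ suc (subst (_∈ applyUpTo suc n) eq (∈-resp-↭ (perm d) (∈-map⁺ (c d) (forestWord⁺ t∈ l∈))))

    positive : ∀ d → p ∈ A → 1 ≤ c d p
    positive d p∈ with coordinate d p∈
    ... | i , _ , eq = subst (1 ≤_) (sym eq) (s≤s z≤n)

    gapless : ∀ d → p ∈ A → ∀ i → 1 ≤ i → i < c d p → ∃ λ q → q ∈ A × c d q ≡ i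
    gapless d p∈ (suc i) _ i<p with coordinate d p∈
    ... | j , j<n , eq
      with ∈-map⁻ (c d) (∈-resp-↭ (↭-sym (perm d))
             -- The entry `suc i` has index `i` in `applyUpTo suc n`, and `suc i < suc j` with
             -- `j < n` bounds that index.
             (∈-applyUpTo⁺ suc (<-trans (≤-pred (subst (suc i <_) eq i<p)) j<n)))
    ...   | q , q∈ , i≡ = q , w⊆A q∈ , sym i≡

    w-length : length (forestWord F) ≡ n
    w-length = trans (sym (length-map x (forestWord F))) (trans (↭-length (perm up)) (length-applyUpTo suc n))

  Valid⇒IsCNAF : IsCanonical A → IsCNAF n A
  Valid⇒IsCNAF ca =
    (ca , (λ _ p∈ → positive up p∈ , positive right p∈) , (λ _ → gapless up) , (λ _ → gapless right) , Unambiguous⇒NoAmbiguity una) ,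
    Branching⇒IsComplete una (Represents⇒Branching rep) ,
    forestWord F , Differ⇒Unique (forestWord-distinct F v) , leaves , w-length
    where
    leaves : ∀ p → p ∈ forestWord F ⇔ (p ∈ A × IsLeaf A p)
    leaves p = mk⇔
      (λ p∈ → w⊆A p∈ , Terminal⇒IsLeaf (Equivalence.from (Represents-leaves rep (w⊆A p∈)) p∈))
      (λ (p∈ , lf) → Equivalence.to (Represents-leaves rep p∈) (IsLeaf⇒Terminal una p∈ lf))

-- Words as pairs of sequences

map-xy-injective : ∀ w w′ → map x w ≡ map x w′ → map y w ≡ map y w′ → w ≡ w′
map-xy-injective []      []        _  _  = refl
map-xy-injective (p ∷ w) (q ∷ w′) xs ys =
  cong₂ _∷_ (cong₂ _,_ (∷-injectiveˡ xs) (∷-injectiveˡ ys)) (map-xy-injective w w′ (∷-injectiveʳ xs) (∷-injectiveʳ ys))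

map-x-zip : ∀ α β → length α ≡ length β → map x (zip α β) ≡ α
map-x-zip []      []      _   = refl
map-x-zip (a ∷ α) (b ∷ β) len = cong (a ∷_) (map-x-zip α β (suc-injective len))

map-y-zip : ∀ α β → length α ≡ length β → map y (zip α β) ≡ β
map-y-zip []      []      _   = refl
map-y-zip (a ∷ α) (b ∷ β) len = cong (b ∷_) (map-y-zip α β (suc-injective len))

steps⇒¬CommonRise : ∀ {w} → Linked Step w → ¬ CommonRise (map x w) (map y w)
steps⇒¬CommonRise (st ∷ _)  (here a< b<) = st (a< , b<)
steps⇒¬CommonRise [-]       (there ())
steps⇒¬CommonRise (_ ∷ sts) (there cr)   = steps⇒¬CommonRise sts cr

¬CommonRise⇒steps : ∀ w → ¬ CommonRise (map x w) (map y w) → Linked Step w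
¬CommonRise⇒steps []          _   = []
¬CommonRise⇒steps (_ ∷ [])    _   = [-]
¬CommonRise⇒steps (_ ∷ q ∷ w) ¬cr = (λ (a< , b<) → ¬cr (here a< b<)) ∷ ¬CommonRise⇒steps (q ∷ w) (¬cr ∘ there)

IsPerm⇒Unique : ∀ {n α} → IsPerm n α → Unique α
IsPerm⇒Unique {n} perm = Permutation.Unique-resp-↭ (setoid ℕ) (↭⇒↭ₛ (↭-sym perm)) (Unique-applyUpTo-suc n)

perms⇒Differ : ∀ {n w} → (∀ d → IsPerm n (map (c d) w)) → AllPairs Differ w
perms⇒Differ perm =
  AllPairs.zipWith (λ (x≢ , y≢) → λ { up → x≢ ; right → y≢ })
    (AllPairs.map⁻ (IsPerm⇒Unique (perm up)) , AllPairs.map⁻ (IsPerm⇒Unique (perm right)))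

-- Assembling the bijection

∈ᶠ⇔∈-points : p ∈ concatMap points F ⇔ p ∈ᶠ F
∈ᶠ⇔∈-points {F = F} = mk⇔
  (λ p∈ → let t , t∈ , p∈t = find (∈-concatMap⁻ points {xs = F} p∈) in t , t∈ , ∈-points⁻ t p∈t)
  (λ (t , t∈ , p∈t) → ∈-concatMap⁺ points (lose t∈ (∈-points⁺ p∈t)))

sequences : PointSet → List ℕ × List ℕ
sequences A = map x (forestWord (forestOf A)) , map y (forestWord (forestOf A))

sequences-injective : ∀ {n} A A′ → IsCNAF n A → IsCNAF n A′ → sequences A ≡ sequences A′ → A ≡ A′
sequences-injective A A′ ca ca′ eq =
  canonical-unique (proj₁ (proj₁ ca)) (proj₁ (proj₁ ca′)) (sub ca ca′ F≡) (sub ca′ ca (sym F≡))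
  where
  F≡ : forestOf A ≡ forestOf A′
  F≡ = forestWord-injective _ _ (IsCNAF-valid ca) (IsCNAF-valid ca′)
         (map-xy-injective _ _ (cong proj₁ eq) (cong proj₂ eq))
  sub : ∀ {n A A′} → IsCNAF n A → IsCNAF n A′ → forestOf A ≡ forestOf A′ → p ∈ A → p ∈ A′
  sub ca ca′ F≡ p∈ =
    Represents-∈ (IsCNAF-represents ca′) (subst (_ ∈ᶠ_) F≡ (Represents-covers (IsCNAF-represents ca) _ ≤-refl p∈))

-- The forest `F` built from the word and the forest `forestOf A` read off its points both represent
-- `A`, so they are equal and the word is recovered.
word⇒IsCNAF : ∀ {n} w → (∀ d → IsPerm n (map (c d) w)) → Linked Step w →
              ∃ λ A → IsCNAF n A × forestWord (forestOf A) ≡ w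
word⇒IsCNAF w perm st with forest-of-word (length w) w ≤-refl (perms⇒Differ perm) st
... | F , v , refl with canonicalise (concatMap points F)
...   | A , ca , A≈ =
  A , cnaf , cong forestWord (Represents-unique (IsCNAF-represents cnaf) (Valid⇒Represents v A≈F))
  where
  A≈F : ∀ {p} → p ∈ A ⇔ p ∈ᶠ F
  A≈F = ∈ᶠ⇔∈-points ⇔-∘ A≈
  cnaf : IsCNAF _ A
  cnaf = Valid⇒IsCNAF v perm A≈F ca

theorem2 : (n : ℕ) → 1 ≤ n →
    BijectionBetween {List (ℕ × ℕ)} {List ℕ × List ℕ} (IsCNAF n) (IsPermPairNoCommonRise n)
theorem2 n _ = sequences , maps , sequences-injective , surjective
  where
  maps : ∀ A → IsCNAF n A → IsPermPairNoCommonRise n (sequences A)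
  maps A ca = IsCNAF-perm ca up , IsCNAF-perm ca right ,
              steps⇒¬CommonRise (forestWord-steps (forestOf A) (IsCNAF-valid ca))
  surjective : ∀ αβ → IsPermPairNoCommonRise n αβ → ∃ λ A → IsCNAF n A × sequences A ≡ αβ
  surjective (α , β) (pα , pβ , ¬cr) =
    let A , cnaf , eq = preimage
    in  A , cnaf , cong₂ _,_ (trans (cong (map x) eq) xs≡) (trans (cong (map y) eq) ys≡)
    where
    len : length α ≡ length β
    len = trans (↭-length pα) (sym (↭-length pβ))
    xs≡ : map x (zip α β) ≡ α
    xs≡ = map-x-zip α β len
    ys≡ : map y (zip α β) ≡ β
    ys≡ = map-y-zip α β len
    preimage : ∃ λ A → IsCNAF n A × forestWord (forestOf A) ≡ zip α β
    preimage = word⇒IsCNAF (zip α β)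
      (λ { up → subst (IsPerm n) (sym xs≡) pα ; right → subst (IsPerm n) (sym ys≡) pβ })
      (¬CommonRise⇒steps (zip α β) (¬cr ∘ subst₂ CommonRise xs≡ ys≡))
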